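{- Let $d\ge 2$ and let $D$ be a (nonempty) $d$-ary tree. If $I_d(D)=\eta_d(D)$, then $$\max_{\substack{\|T\|=(d-1)n+1\\ T\text{ strictly }d\text{ -ary tree}}}\gamma(D,T)=I_d(D)+\mathcal{O}(n^{ -1})$$ as $n\to\infty$.
   Context: A $d$-ary tree is a finite rooted tree in which every internal (non-leaf) vertex has at least two and at most $d$ children; a single vertex is a $d$-ary tree with one leaf. A strictly $d$-ary tree is a rooted tree in which every internal vertex has exactly $d$ children (its number of leaves is always congruent to $1$ modulo $d-1$). Isomorphism means root-preserving isomorphism. $\|T\|$ denotes the number of leaves of $T$. A set $S$ of leaves of $T$ induces a $d$-ary tree: take the smallest subtree of $T$ containing all leaves in $S$ (rooted at the most recent common ancestor of $S$) and repeatedly suppress every vertex with exactly one child (contracting its two adjacent edges to a single edge). $c(D,T)$ is the number of sets of $\|D\|$ leaves of $T$ that induce a tree isomorphic to $D$, and $\gamma(D,T)=c(D,T)/\binom{\|T\|}{\|D\|}$. The $d$-ary inducibility of a $d$-ary tree $D$ is $$I_d(D)=\limsup_{n\to\infty}\ \max_{\substack{\|T\|=n\\ T\ d\text{ -ary tree}}}\gamma(D,T).$$ The strictly $d$-ary trees $H_n^d$ ($n\ge 0$) are defined recursively: $H_0^d$ is a single leaf; for $n>0$ write $n-1=ds+b$ with $b\in\{0,1,\ldots,d-1\}$, take $d-b$ copies of $H_s^d$ and $b$ copies of $H_{s+1}^d$, and connect a new common root to each of their roots by an edge to obtain $H_n^d$, which has $(d-1)n+1$ leaves. For a $d$-ary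 tree $D$, $\eta_d(D)=\lim_{n\to\infty}\gamma(D,H_n^d)$ (this limit exists). -}

module Defs where

open import Data.Fin.Subset using (Subset; inside; outside; ∣_∣)
open import Data.Integer using (+_)
open import Data.List.Base using (List; []; _∷_; _++_; length; map; filter; replicate; fromMaybe; cartesianProductWith)
open import Data.List.Membership.Propositional using (_∈_)
open import Data.List.Membership.Propositional.Properties using (∈-map⁺; ∈-filter⁺; ∈-filter⁻; ∈-cartesianProductWith⁺)
import Data.List.Membership.Setoid.Properties as Membershipₛ
import Data.List.Relation.Binary.Permutation.Homogeneous as Homogeneous
open Homogeneous using (Permutation)
import Data.List.Relation.Binary.Permutation.Setoid as Permutationₛ
import Data.List.Relation.Binary.Permutation.Setoid.Properties as Permutationₛₚ
open import Data.List.Relation.Binary.Pointwise.Base using (Pointwise; []; _∷_)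
open import Data.List.Relation.Unary.All using (All; []; _∷_)
open import Data.List.Relation.Unary.Any using (here; there)
import Data.List.Relation.Unary.Any as Any
open import Data.Maybe.Base using (Maybe; just; nothing)
import Data.Maybe.Relation.Unary.Any as Maybe
open import Data.Nat.Base as ℕ using (ℕ; zero; suc; _+_; _*_; _∸_; _≤_; _<_; z≤n; s≤s; s≤s⁻¹; NonZero; NonTrivial; nonTrivial⇒nonZero)
open import Data.Nat.Combinatorics using (_C_)
open import Data.Nat.DivMod using (_/_; _%_; m/n≤m; m≡m%n+[m/n]*n)
import Data.Nat.Properties as ℕ
open import Data.Product using (_×_; _,_; ∃; proj₂)
open import Data.Rational.Base as ℚ using (ℚ; 0ℚ; ½)
import Data.Rational.Properties as ℚ
open import Relation.Binary.Bundles using (Setoid; module DecTotalOrder)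
open import Data.List.Extrema (DecTotalOrder.totalOrder ℚ.≤-decTotalOrder) using (max)
open import Data.Sum.Base using (inj₁; inj₂)
open import Data.Vec.Base using ([]; _∷_; take; drop)
open import Function.Base using (_∘_)
open import Function.Bundles using (_⇔_; mk⇔)
open import Level using (0ℓ)
open import Relation.Binary.PropositionalEquality using (_≡_; refl; sym; trans; cong; cong₂; subst; subst₂)
open import Relation.Nullary using (Dec; yes; no)
open import Relation.Nullary.Decidable using (_×-dec_; map′)

-- The children of a vertex are listed in some order; the order is
-- forgotten by _≅_ below.  A leaf is a vertex without children.

data Tree : Set where
  node : List Tree → Tree

infix 4 _≅_

data _≅_ : Tree → Tree → Set where
  node : ∀ {ts us} → Permutation _≅_ ts us → node ts ≅ node us

mutual
  leaves : Tree → ℕ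
  leaves (node [])          = 1
  leaves (node ts@(_ ∷ _)) = leaves* ts

  leaves* : List Tree → ℕ
  leaves* []       = 0
  leaves* (t ∷ ts) = leaves t + leaves* ts

data IsDary (d : ℕ) : Tree → Set where
  leaf     : IsDary d (node [])
  internal : ∀ {ts} → 2 ≤ length ts → length ts ≤ d →
             All (IsDary d) ts → IsDary d (node ts)

data IsStrictlyDary (d : ℕ) : Tree → Set where
  leaf     : IsStrictlyDary d (node [])
  internal : ∀ {ts} → length ts ≡ d →
             All (IsStrictlyDary d) ts → IsStrictlyDary d (node ts)

mutual
  ≅-refl : ∀ {t} → t ≅ t
  ≅-refl {node ts} = node (Homogeneous.refl ≅*-refl)

  ≅*-refl : ∀ {ts} → Pointwise _≅_ ts ts
  ≅*-refl {[]}     = []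
  ≅*-refl {t ∷ ts} = ≅-refl ∷ ≅*-refl

mutual
  ≅-sym : ∀ {t u} → t ≅ u → u ≅ t
  ≅-sym (node p) = node (↭-sym p)

  ↭-sym : ∀ {ts us} → Permutation _≅_ ts us → Permutation _≅_ us ts
  ↭-sym (Homogeneous.refl p)     = Homogeneous.refl (≅*-sym p)
  ↭-sym (Homogeneous.prep e p)   = Homogeneous.prep (≅-sym e) (↭-sym p)
  ↭-sym (Homogeneous.swap e f p) = Homogeneous.swap (≅-sym f) (≅-sym e) (↭-sym p)
  ↭-sym (Homogeneous.trans p q)  = Homogeneous.trans (↭-sym q) (↭-sym p)

  ≅*-sym : ∀ {ts us} → Pointwise _≅_ ts us → Pointwise _≅_ us ts
  ≅*-sym []      = []
  ≅*-sym (e ∷ p) = ≅-sym e ∷ ≅*-sym p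

≅-trans : ∀ {t u v} → t ≅ u → u ≅ v → t ≅ v
≅-trans (node p) (node q) = node (Homogeneous.trans p q)

≅-setoid : Setoid 0ℓ 0ℓ
≅-setoid = record
  { Carrier = Tree
  ; _≈_ = _≅_
  ; isEquivalence = record { refl = ≅-refl ; sym = ≅-sym ; trans = ≅-trans }
  }

private
  module ↭ = Permutationₛ ≅-setoid
  module ↭ₚ = Permutationₛₚ ≅-setoid

mutual
  infix 4 _≅?_

  _≅?_ : ∀ t u → Dec (t ≅ u)
  node ts ≅? node us = map′ node (λ { (node p) → p }) (ts ↭? us)

  _↭?_ : ∀ ts us → Dec (Permutation _≅_ ts us)
  []       ↭? []       = yes (Homogeneous.refl [])
  []       ↭? (u ∷ us) = no (↭ₚ.¬x∷xs↭[] ∘ ↭-sym)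
  (t ∷ ts) ↭? us       with Any.any? (λ u → t ≅? u) us
  ... | no t∉us  = no λ p → t∉us (↭ₚ.∈-resp-↭ p (here ≅-refl))
  ... | yes t∈us with Membershipₛ.∈-∃++ ≅-setoid t∈us
  ...   | as , bs , w , t≅w , us≋ with ts ↭? (as ++ bs)
  ...     | yes p = yes (Homogeneous.trans (Homogeneous.prep t≅w p)
                      (Homogeneous.trans (↭-sym (↭ₚ.↭-shift as bs)) (↭-sym (Homogeneous.refl us≋))))
  ...     | no ¬p = no λ p → ¬p (↭ₚ.drop-∷ (Homogeneous.trans p
                      (Homogeneous.trans (Homogeneous.refl us≋) (↭ₚ.shift (≅-sym t≅w) as bs))))

mutual
  isDary? : ∀ d t → Dec (IsDary d t)
  isDary? d (node []) = yes leaf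
  isDary? d (node ts@(_ ∷ _)) =
    map′ (λ { (p , q , r) → internal p q r }) (λ { (internal p q r) → p , q , r })
      (2 ℕ.≤? length ts ×-dec length ts ℕ.≤? d ×-dec isDary*? d ts)

  isDary*? : ∀ d ts → Dec (All (IsDary d) ts)
  isDary*? d []       = yes []
  isDary*? d (t ∷ ts) =
    map′ (λ { (p , q) → p ∷ q }) (λ { (p ∷ q) → p , q }) (isDary? d t ×-dec isDary*? d ts)

mutual
  isStrictlyDary? : ∀ d t → Dec (IsStrictlyDary d t)
  isStrictlyDary? d (node []) = yes leaf
  isStrictlyDary? d (node ts@(_ ∷ _)) =
    map′ (λ { (p , q) → internal p q }) (λ { (internal p q) → p , q })
      (length ts ℕ.≟ d ×-dec isStrictlyDary*? d ts)

  isStrictlyDary*? : ∀ d ts → Dec (All (IsStrictlyDary d) ts)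
  isStrictlyDary*? d []       = yes []
  isStrictlyDary*? d (t ∷ ts) =
    map′ (λ { (p , q) → p ∷ q }) (λ { (p ∷ q) → p , q })
      (isStrictlyDary? d t ×-dec isStrictlyDary*? d ts)

-- A set of leaves of t is a Subset (leaves t), the leaves being numbered
-- from left to right.  span t S is the smallest subtree containing S and
-- the root of t, or nothing when S is empty.

mutual
  span : (t : Tree) → Subset (leaves t) → Maybe Tree
  span (node [])          (inside  ∷ []) = just (node [])
  span (node [])          (outside ∷ []) = nothing
  span (node ts@(_ ∷ _)) S              = join (span* ts S)
    where
    join : List Tree → Maybe Tree
    join []          = nothing
    join us@(_ ∷ _) = just (node us)

  span* : (ts : List Tree) → Subset (leaves* ts) → List Tree
  span* []       S = []
  span* (t ∷ ts) S = fromMaybe (span t (take (leaves t) S)) ++ span* ts (drop (leaves t) S)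

-- In span t S all vertices strictly above the most recent common ancestor
-- of S have exactly one child, so suppressing them also moves the root to
-- that ancestor.

mutual
  suppress : Tree → Tree
  suppress (node [])               = node []
  suppress (node (t ∷ []))         = suppress t
  suppress (node ts@(_ ∷ _ ∷ _)) = node (suppress* ts)

  suppress* : List Tree → List Tree
  suppress* []       = []
  suppress* (t ∷ ts) = suppress t ∷ suppress* ts

Induces : (T : Tree) → Subset (leaves T) → Tree → Set
Induces T S D = Maybe.Any (λ U → suppress U ≅ D) (span T S)

induces? : ∀ T S D → Dec (Induces T S D)
induces? T S D = Maybe.dec (λ U → suppress U ≅? D) (span T S)

subsets : ∀ n → List (Subset n)
subsets zero    = [] ∷ []
subsets (suc n) = map (outside ∷_) (subsets n) ++ map (inside ∷_) (subsets n)

c : Tree → Tree → ℕ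
c D T = length (filter (λ S → ∣ S ∣ ℕ.≟ leaves D ×-dec induces? T S D) (subsets (leaves T)))

-- The clause for 0 is a convention, used in γ only when leaves T < leaves D.

ratio : ℕ → ℕ → ℚ
ratio m zero      = 0ℚ
ratio m n@(suc _) = + m ℚ./ n

γ : Tree → Tree → ℚ
γ D T = ratio (c D T) (leaves T C leaves D)

lists≤ : {A : Set} → ℕ → List A → List (List A)
lists≤ zero    xs = [] ∷ []
lists≤ (suc k) xs = [] ∷ cartesianProductWith _∷_ xs (lists≤ k xs)

-- All trees on at most h levels with at most d children at each vertex.

trees≤ : ℕ → ℕ → List Tree
trees≤ d zero    = []
trees≤ d (suc h) = map node (lists≤ d (trees≤ d h))

daryTrees : ℕ → ℕ → List Tree
daryTrees d n = filter (λ T → isDary? d T ×-dec leaves T ℕ.≟ n) (trees≤ d n)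

strictlyDaryTrees : ℕ → ℕ → List Tree
strictlyDaryTrees d n = filter (λ T → isStrictlyDary? d T ×-dec leaves T ℕ.≟ n) (trees≤ d n)

-- The bottom value 0 is irrelevant to a nonempty maximum, as γ ≥ 0.

maxDaryγ : ℕ → Tree → ℕ → ℚ
maxDaryγ d D n = max 0ℚ (map (γ D) (daryTrees d n))

maxStrictlyDaryγ : ℕ → Tree → ℕ → ℚ
maxStrictlyDaryγ d D n = max 0ℚ (map (γ D) (strictlyDaryTrees d n))

∈-lists≤ : ∀ {A : Set} {xs : List A} k {ys} →
           length ys ≤ k → All (_∈ xs) ys → ys ∈ lists≤ k xs
∈-lists≤ zero    {[]}     _ _ = here refl
∈-lists≤ (suc k) {[]}     _ _ = here refl
∈-lists≤ (suc k) {y ∷ ys} (s≤s l) (p ∷ ps) =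
  there (∈-cartesianProductWith⁺ _∷_ p (∈-lists≤ k l ps))

leaves>0 : ∀ t → 0 < leaves t
leaves>0 (node [])       = s≤s z≤n
leaves>0 (node (t ∷ ts)) = ℕ.≤-trans (leaves>0 t) (ℕ.m≤m+n (leaves t) _)

leaves≤leaves* : ∀ {h} ts → leaves* ts ≤ h → All (λ t → leaves t ≤ h) ts
leaves≤leaves* []       l = []
leaves≤leaves* (t ∷ ts) l =
  ℕ.m+n≤o⇒m≤o (leaves t) l ∷ leaves≤leaves* ts (ℕ.m+n≤o⇒n≤o (leaves t) l)

leaves<leaves* : ∀ {h} ts → 2 ≤ length ts → leaves* ts ≤ suc h → All (λ t → leaves t ≤ h) ts
leaves<leaves* (t ∷ u ∷ ts) _ l =
  s≤s⁻¹ (ℕ.≤-trans (ℕ.≤-reflexive (ℕ.+-comm 1 (leaves t)))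
    (ℕ.≤-trans (ℕ.+-monoʳ-≤ (leaves t) (leaves>0 (node (u ∷ ts)))) l))
  ∷ leaves≤leaves* (u ∷ ts) (s≤s⁻¹ (ℕ.≤-trans (ℕ.+-monoˡ-≤ _ (leaves>0 t)) l))
leaves<leaves* (_ ∷ []) (s≤s ()) _

mutual
  ∈-trees≤ : ∀ {d T} h → IsDary d T → leaves T ≤ h → T ∈ trees≤ d h
  ∈-trees≤ {T = T} zero _ l with leaves T | leaves>0 T
  ∈-trees≤ zero _ () | suc _ | _
  ∈-trees≤ {d} (suc h) leaf l = ∈-map⁺ node (∈-lists≤ d z≤n [])
  ∈-trees≤ {d} (suc h) (internal {ts@(_ ∷ _)} p q r) l =
    ∈-map⁺ node (∈-lists≤ d q (∈-trees≤* h r (leaves<leaves* ts p l)))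

  ∈-trees≤* : ∀ {d ts} h → All (IsDary d) ts → All (λ t → leaves t ≤ h) ts → All (_∈ trees≤ d h) ts
  ∈-trees≤* h []       []       = []
  ∈-trees≤* h (r ∷ rs) (l ∷ ls) = ∈-trees≤ h r l ∷ ∈-trees≤* h rs ls

mutual
  strictlyDary⇒dary : ∀ {d T} → 2 ≤ d → IsStrictlyDary d T → IsDary d T
  strictlyDary⇒dary 2≤d leaf            = leaf
  strictlyDary⇒dary 2≤d (internal refl r) = internal 2≤d ℕ.≤-refl (strictlyDary⇒dary* 2≤d r)

  strictlyDary⇒dary* : ∀ {d ts} → 2 ≤ d → All (IsStrictlyDary d) ts → All (IsDary d) ts
  strictlyDary⇒dary* 2≤d []       = []
  strictlyDary⇒dary* 2≤d (r ∷ rs) = strictlyDary⇒dary 2≤d r ∷ strictlyDary⇒dary* 2≤d rs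

∈-daryTrees : ∀ {d n T} → T ∈ daryTrees d n ⇔ (IsDary d T × leaves T ≡ n)
∈-daryTrees {d} {n} = mk⇔
  (λ p → proj₂ (∈-filter⁻ (λ T → isDary? d T ×-dec leaves T ℕ.≟ n) {xs = trees≤ d n} p))
  (λ { (p , refl) → ∈-filter⁺ (λ T → isDary? d T ×-dec leaves T ℕ.≟ n)
                      (∈-trees≤ n p ℕ.≤-refl) (p , refl) })

∈-strictlyDaryTrees : ∀ {d n T} → 2 ≤ d →
                      T ∈ strictlyDaryTrees d n ⇔ (IsStrictlyDary d T × leaves T ≡ n)
∈-strictlyDaryTrees {d} {n} 2≤d = mk⇔
  (λ p → proj₂ (∈-filter⁻ (λ T → isStrictlyDary? d T ×-dec leaves T ℕ.≟ n) {xs = trees≤ d n} p))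
  (λ { (p , refl) → ∈-filter⁺ (λ T → isStrictlyDary? d T ×-dec leaves T ℕ.≟ n)
                      (∈-trees≤ n (strictlyDary⇒dary 2≤d p) ℕ.≤-refl) (p , refl) })

-- The first argument of H-within bounds the recursion depth; H-suc shows that
-- H satisfies the unbounded recursion.

module _ (d : ℕ) .{{_ : NonTrivial d}} where

  private
    instance
      d≢0 : NonZero d
      d≢0 = nonTrivial⇒nonZero d

  H-within : ℕ → ℕ → Tree
  H-within _       zero    = node []
  H-within zero    (suc m) = node []
  H-within (suc k) (suc m) =
    node (replicate (d ∸ m % d) (H-within k (m / d)) ++
          replicate (m % d) (H-within k (suc (m / d))))

  H : ℕ → Tree
  H n = H-within n n

  private
    replicate-cong : ∀ b {x y : Tree} → (0 < b → x ≡ y) → replicate b x ≡ replicate b y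
    replicate-cong zero    eq = refl
    replicate-cong (suc b) eq = cong (replicate (suc b)) (eq (s≤s z≤n))

    suc[m/d]≤m : ∀ m → 0 < m % d → suc (m / d) ≤ m
    suc[m/d]≤m m 0<b = begin
      1 + m / d             ≤⟨ ℕ.+-mono-≤ 0<b (ℕ.m≤m*n (m / d) d) ⟩
      m % d + m / d * d     ≡⟨ m≡m%n+[m/n]*n m d ⟨
      m                     ∎
      where open ℕ.≤-Reasoning

    H-within-irrelevant : ∀ k l n → n ≤ k → n ≤ l → H-within k n ≡ H-within l n
    H-within-irrelevant zero    zero    zero    p q = refl
    H-within-irrelevant zero    (suc l) zero    p q = refl
    H-within-irrelevant (suc k) zero    zero    p q = refl
    H-within-irrelevant (suc k) (suc l) zero    p q = refl
    H-within-irrelevant (suc k) (suc l) (suc m) (s≤s p) (s≤s q) = cong node (cong₂ _++_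
      (cong (replicate (d ∸ m % d)) (H-within-irrelevant k l (m / d)
        (ℕ.≤-trans (m/n≤m m d) p) (ℕ.≤-trans (m/n≤m m d) q)))
      (replicate-cong (m % d) λ 0<b → H-within-irrelevant k l (suc (m / d))
        (ℕ.≤-trans (suc[m/d]≤m m 0<b) p) (ℕ.≤-trans (suc[m/d]≤m m 0<b) q)))

  H-suc : ∀ m → H (suc m) ≡ node (replicate (d ∸ m % d) (H (m / d)) ++
                                  replicate (m % d) (H (suc (m / d))))
  H-suc m = cong node (cong₂ _++_
    (cong (replicate (d ∸ m % d)) (H-within-irrelevant m (m / d) (m / d) (m/n≤m m d) ℕ.≤-refl))
    (replicate-cong (m % d) λ 0<b →
      H-within-irrelevant m (suc (m / d)) (suc (m / d)) (suc[m/d]≤m m 0<b) ℕ.≤-refl))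

-- A real number is a Cauchy sequence of rationals; equality is _≈ᴿ_.

record ℝ : Set where
  field
    seq    : ℕ → ℚ
    cauchy : ∀ ε → 0ℚ ℚ.< ε → ∃ λ N → ∀ m n → N ≤ m → N ≤ n →
             ℚ.∣ seq m ℚ.- seq n ∣ ℚ.≤ ε

open ℝ public

infix 4 _≤ᴿ_ _≈ᴿ_

_≤ᴿ_ : ℝ → ℝ → Set
x ≤ᴿ y = ∀ ε → 0ℚ ℚ.< ε → ∃ λ N → ∀ n → N ≤ n → seq x n ℚ.≤ seq y n ℚ.+ ε

_≈ᴿ_ : ℝ → ℝ → Set
x ≈ᴿ y = x ≤ᴿ y × y ≤ᴿ x

fromℚ : ℚ → ℝ
fromℚ q = record
  { seq    = λ _ → q
  ; cauchy = λ ε 0<ε → 0 , λ _ _ _ _ →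
      subst (ℚ._≤ ε) (cong ℚ.∣_∣ (sym (ℚ.+-inverseʳ q))) (ℚ.<⇒≤ 0<ε)
  }

private
  half>0 : ∀ {ε} → 0ℚ ℚ.< ε → 0ℚ ℚ.< ½ ℚ.* ε
  half>0 {ε} 0<ε = subst (ℚ._< ½ ℚ.* ε) (ℚ.*-zeroʳ ½) (ℚ.*-monoʳ-<-pos ½ 0<ε)

  half+half : ∀ ε → ½ ℚ.* ε ℚ.+ ½ ℚ.* ε ≡ ε
  half+half ε = trans (sym (ℚ.*-distribʳ-+ ε ½ ½)) (ℚ.*-identityˡ ε)

  ∣-∣-interchange : ∀ a b a′ b′ → ℚ.∣ (a ℚ.- b) ℚ.- (a′ ℚ.- b′) ∣ ℚ.≤ ℚ.∣ a ℚ.- a′ ∣ ℚ.+ ℚ.∣ b ℚ.- b′ ∣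
  ∣-∣-interchange a b a′ b′ =
    subst (λ q → ℚ.∣ q ∣ ℚ.≤ ℚ.∣ a ℚ.- a′ ∣ ℚ.+ ℚ.∣ b ℚ.- b′ ∣) eq
      (ℚ.∣p-q∣≤∣p∣+∣q∣ (a ℚ.- a′) (b ℚ.- b′))
    where
    open import Data.Rational.Solver
    open +-*-Solver
    eq : (a ℚ.- a′) ℚ.- (b ℚ.- b′) ≡ (a ℚ.- b) ℚ.- (a′ ℚ.- b′)
    eq = solve 4 (λ a b a′ b′ → (a :- a′) :- (b :- b′) := (a :- b) :- (a′ :- b′)) refl a b a′ b′

  p-q≤r : ∀ {p q r} → p ℚ.≤ r ℚ.+ q → p ℚ.- q ℚ.≤ r
  p-q≤r {p} {q} {r} l = subst (p ℚ.- q ℚ.≤_) eq (ℚ.+-monoˡ-≤ (ℚ.- q) l)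
    where
    eq : (r ℚ.+ q) ℚ.- q ≡ r
    eq = trans (ℚ.+-assoc r q (ℚ.- q)) (trans (cong (r ℚ.+_) (ℚ.+-inverseʳ q)) (ℚ.+-identityʳ r))

  ∣p∣≤∣p-q∣+∣q∣ : ∀ p q → ℚ.∣ p ∣ ℚ.≤ ℚ.∣ p ℚ.- q ∣ ℚ.+ ℚ.∣ q ∣
  ∣p∣≤∣p-q∣+∣q∣ p q = subst (λ x → ℚ.∣ x ∣ ℚ.≤ ℚ.∣ p ℚ.- q ∣ ℚ.+ ℚ.∣ q ∣) eq
    (ℚ.∣p+q∣≤∣p∣+∣q∣ (p ℚ.- q) q)
    where
    eq : (p ℚ.- q) ℚ.+ q ≡ p
    eq = trans (ℚ.+-assoc p (ℚ.- q) q) (trans (cong (p ℚ.+_) (ℚ.+-inverseˡ q)) (ℚ.+-identityʳ p))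

  -[p-q]≡q-p : ∀ p q → ℚ.- (p ℚ.- q) ≡ q ℚ.- p
  -[p-q]≡q-p p q = solve 2 (λ p q → :- (p :- q) := q :- p) refl p q
    where
    open import Data.Rational.Solver
    open +-*-Solver

  ∣∣p∣-∣q∣∣≤∣p-q∣ : ∀ p q → ℚ.∣ ℚ.∣ p ∣ ℚ.- ℚ.∣ q ∣ ∣ ℚ.≤ ℚ.∣ p ℚ.- q ∣
  ∣∣p∣-∣q∣∣≤∣p-q∣ p q with ℚ.∣p∣≡p∨∣p∣≡-p (ℚ.∣ p ∣ ℚ.- ℚ.∣ q ∣)
  ... | inj₁ eq = subst (ℚ._≤ ℚ.∣ p ℚ.- q ∣) (sym eq) (p-q≤r (∣p∣≤∣p-q∣+∣q∣ p q))
  ... | inj₂ eq = subst₂ ℚ._≤_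
    (trans (sym (-[p-q]≡q-p ℚ.∣ p ∣ ℚ.∣ q ∣)) (sym eq))
    (trans (cong ℚ.∣_∣ (sym (-[p-q]≡q-p p q))) (ℚ.∣-p∣≡∣p∣ (p ℚ.- q)))
    (p-q≤r (∣p∣≤∣p-q∣+∣q∣ q p))

infixl 6 _-ᴿ_

_-ᴿ_ : ℝ → ℝ → ℝ
x -ᴿ y = record
  { seq    = λ n → seq x n ℚ.- seq y n
  ; cauchy = λ ε 0<ε →
      let M , p = cauchy x (½ ℚ.* ε) (half>0 0<ε)
          N , q = cauchy y (½ ℚ.* ε) (half>0 0<ε)
      in M ℕ.⊔ N , λ m n l k →
        ℚ.≤-trans (∣-∣-interchange (seq x m) (seq y m) (seq x n) (seq y n))
          (ℚ.≤-trans
            (ℚ.+-mono-≤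
              (p m n (ℕ.≤-trans (ℕ.m≤m⊔n M N) l) (ℕ.≤-trans (ℕ.m≤m⊔n M N) k))
              (q m n (ℕ.≤-trans (ℕ.m≤n⊔m M N) l) (ℕ.≤-trans (ℕ.m≤n⊔m M N) k)))
            (ℚ.≤-reflexive (half+half ε)))
  }

∣_∣ᴿ : ℝ → ℝ
∣ x ∣ᴿ = record
  { seq    = λ n → ℚ.∣ seq x n ∣
  ; cauchy = λ ε 0<ε →
      let N , p = cauchy x ε 0<ε
      in N , λ m n l k → ℚ.≤-trans (∣∣p∣-∣q∣∣≤∣p-q∣ (seq x m) (seq x n)) (p m n l k)
  }

IsLimit : (ℕ → ℝ) → ℝ → Set
IsLimit a L = ∀ ε → 0ℚ ℚ.< ε → ∃ λ N → ∀ n → N ≤ n → ∣ a n -ᴿ L ∣ᴿ ≤ᴿ fromℚ ε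

IsSup : (ℕ → ℝ) → ℝ → Set
IsSup a s = (∀ k → a k ≤ᴿ s) × (∀ u → (∀ k → a k ≤ᴿ u) → s ≤ᴿ u)

IsInf : (ℕ → ℝ) → ℝ → Set
IsInf a s = (∀ k → s ≤ᴿ a k) × (∀ u → (∀ k → u ≤ᴿ a k) → u ≤ᴿ s)

IsLimsup : (ℕ → ℝ) → ℝ → Set
IsLimsup a L = ∃ λ s → (∀ n → IsSup (λ k → a (n + k)) (s n)) × IsInf s L

IsO[1/n] : (ℕ → ℝ) → Set
IsO[1/n] e = ∃ λ (C : ℚ) → ∃ λ N → ∀ n .{{_ : NonZero n}} → N ≤ n →
             ∣ e n ∣ᴿ ≤ᴿ fromℚ (C ℚ.* (+ 1 ℚ./ n))

IsInducibility : ℕ → Tree → ℝ → Set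
IsInducibility d D I = IsLimsup (λ n → fromℚ (maxDaryγ d D n)) I

IsBalancedDensity : (d : ℕ) .{{_ : NonTrivial d}} → Tree → ℝ → Set
IsBalancedDensity d D η = IsLimit (λ n → fromℚ (γ D (H d n))) η

-- For a fixed D with k leaves, let W T k φ be the sum of φ over the trees induced
-- by the k-element sets of leaves of T, so that c D T = W T k (is D).
--
-- Upper bound: grafting a tree with L leaves at each of the N leaves of T multiplies
-- c D T by at least L^k, and the binomial coefficient below it by at most
-- L^k (1 + O(1/N)).  So arbitrarily large d-ary trees have density at least
-- γ D T − O(1/N), whence γ D T ≤ I + O(1/N).
--
-- Lower bound: let N be the number of leaves of H n, and K h the complete d-ary tree
-- with q = d^h leaves.  Then W (K h) k φ / q^k ≤ W (H n) k φ / N^k + O(1/N),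
-- uniformly in h and in φ ≤ 1, by induction on k and h.  Indeed the branches of H n
-- have N/d + O(1) leaves, and the errors C/Nᵢ of the branches, weighted by the
-- probabilities (Nᵢ/N)^k that all k leaves fall into the same branch, add up to
-- C/N · Σ (Nᵢ/N)^(k−1) ≤ C/N · maxᵢ Nᵢ/N ≤ ⅔ C/N when k ≥ 3, while for k ≤ 2 the
-- induced tree is unique.  Letting h → ∞ gives γ D (H n) ≥ η − O(1/N), and η = I.

module Submission where

open import Defs
open import Data.Bool.Base using (Bool; true; false; _∧_; if_then_else_)
open import Data.Fin.Subset using (Subset; inside; outside; ∣_∣)
import Data.Integer.Base as ℤ
import Data.Integer.Properties as ℤ
open import Data.List.Base using (List; []; _∷_; _++_; length; map; filter; replicate; fromMaybe)
open import Data.List.Membership.Propositional.Properties using (∈-map⁺)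
open import Data.List.Properties using (map-++; map-∘; length-++; length-replicate; ++-identityʳ)
open import Data.List.Relation.Unary.All as All using (All; []; _∷_)
import Data.List.Relation.Unary.All.Properties as All
open import Data.Maybe.Base as Maybe using (Maybe; just; nothing)
import Data.Maybe.Relation.Unary.Any as MaybeAny
open import Data.Nat.Base as ℕ using (ℕ; zero; suc; _+_; _*_; _∸_; _^_; _≤_; _<_; z≤n; s≤s; s≤s⁻¹; _≡ᵇ_; NonTrivial; NonZero; >-nonZero; nonTrivial⇒n>1)
open import Data.Nat.Combinatorics using (_C_; nCk+nC[k+1]≡[n+1]C[k+1]; nC1≡n; nCn≡1; k>n⇒nCk≡0)
open import Data.Nat.DivMod using (_/_; _%_; m≡m%n+[m/n]*n; m/n≤m; m%n<n; m*n%n≡0; m*n/n≡m)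
open import Data.Nat.Induction using (<-rec)
open import Data.Nat.ListAction using (sum)
open import Data.Nat.ListAction.Properties using (sum-++)
open import Data.Nat.Properties
open import Algebra.Properties.CommutativeSemigroup +-commutativeSemigroup using () renaming (interchange to +-interchange)
open import Algebra.Properties.CommutativeSemigroup *-commutativeSemigroup using (x∙yz≈y∙xz) renaming (interchange to *-interchange)
open import Data.Nat.Tactic.RingSolver using (solve-∀)
open import Data.Product using (_×_; _,_; ∃; proj₁; proj₂)
open import Data.Rational.Base as ℚ using (ℚ; 0ℚ; ½)
import Data.Rational.Properties as ℚ
open import Data.Rational.Solver using (module +-*-Solver)
import Data.Rational.Unnormalised.Base as ℚᵘ
import Data.Rational.Unnormalised.Properties as ℚᵘ
open import Data.Sum.Base using (inj₁; inj₂; [_,_]′)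
open import Data.Vec.Base using ([]; _∷_; take; drop)
open import Function.Base using (_∘_; const)
open import Function.Bundles using (module Equivalence)
open import Level using (0ℓ)
open import Relation.Binary.Bundles using (module DecTotalOrder)
open import Data.List.Extrema (DecTotalOrder.totalOrder ℚ.≤-decTotalOrder) using (max≤v⁺; xs≤max; ⊥≤max)
open import Relation.Binary.PropositionalEquality using (_≡_; refl; sym; trans; cong; cong₂; subst; subst₂; module ≡-Reasoning)
open import Relation.Nullary using (does)
open import Relation.Nullary.Decidable using (_×-dec_)
open import Relation.Unary using (Pred; Decidable)

-- Convolutions

-- Summation over all pairs with i + l = k, the two parts of a set of `k` leaves split between one
-- tree and the trees after it.
conv : ℕ → (ℕ → ℕ → ℕ) → ℕ
conv zero    f = f 0 0
conv (suc k) f = f 0 (suc k) + conv k (λ i → f (suc i))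

conv-mono : ∀ k {f g} → (∀ i l → i + l ≡ k → f i l ≤ g i l) → conv k f ≤ conv k g
conv-mono zero    f≤g = f≤g 0 0 refl
conv-mono (suc k) f≤g =
  +-mono-≤ (f≤g 0 (suc k) refl) (conv-mono k λ i l eq → f≤g (suc i) l (cong suc eq))

conv-+ : ∀ k f g → conv k (λ i l → f i l + g i l) ≡ conv k f + conv k g
conv-+ zero    f g = refl
conv-+ (suc k) f g =
  trans (cong (f 0 (suc k) + g 0 (suc k) +_) (conv-+ k (f ∘ suc) (g ∘ suc)))
        (+-interchange (f 0 (suc k)) (g 0 (suc k)) (conv k (f ∘ suc)) (conv k (g ∘ suc)))

conv-* : ∀ k a f → conv k (λ i l → a * f i l) ≡ a * conv k f
conv-* zero    a f = refl
conv-* (suc k) a f =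
  trans (cong (a * f 0 (suc k) +_) (conv-* k a (f ∘ suc)))
        (sym (*-distribˡ-+ a (f 0 (suc k)) _))

conv-const : ∀ k a → conv k (λ _ _ → a) ≡ suc k * a
conv-const zero    a = sym (+-identityʳ a)
conv-const (suc k) a = cong (a +_) (conv-const k a)

-- The recursion exposes the term with i = 0; `forestError-top` also needs the opposite end split
-- off, where all leaves lie in the first tree.
conv-last : ∀ k f → conv (suc k) f ≡ conv k (λ i l → f i (suc l)) + f (suc k) 0
conv-last zero    f = refl
conv-last (suc k) f =
  trans (cong (f 0 (2 + k) +_) (conv-last k (f ∘ suc))) (sym (+-assoc (f 0 (2 + k)) _ _))

-- Sums over subsets

-- ∑ n k f is the sum of f S over the k-element subsets S of an n-set.

∑ : ∀ n → ℕ → (Subset n → ℕ) → ℕ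
∑ zero    zero    f = f []
∑ zero    (suc k) f = 0
∑ (suc n) zero    f = ∑ n zero (f ∘ (outside ∷_))
∑ (suc n) (suc k) f = ∑ n (suc k) (f ∘ (outside ∷_)) + ∑ n k (f ∘ (inside ∷_))

∑-mono : ∀ n k {f g} → (∀ S → f S ≤ g S) → ∑ n k f ≤ ∑ n k g
∑-mono zero    zero    f≤g = f≤g []
∑-mono zero    (suc k) f≤g = z≤n
∑-mono (suc n) zero    f≤g = ∑-mono n zero (f≤g ∘ (outside ∷_))
∑-mono (suc n) (suc k) f≤g =
  +-mono-≤ (∑-mono n (suc k) (f≤g ∘ (outside ∷_))) (∑-mono n k (f≤g ∘ (inside ∷_)))

∑-cong : ∀ n k {f g} → (∀ S → f S ≡ g S) → ∑ n k f ≡ ∑ n k g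
∑-cong n k f≡g =
  ≤-antisym (∑-mono n k (≤-reflexive ∘ f≡g)) (∑-mono n k (≤-reflexive ∘ sym ∘ f≡g))

∑-+ : ∀ n k f g → ∑ n k (λ S → f S + g S) ≡ ∑ n k f + ∑ n k g
∑-+ zero    zero    f g = refl
∑-+ zero    (suc k) f g = refl
∑-+ (suc n) zero    f g = ∑-+ n zero (f ∘ (outside ∷_)) (g ∘ (outside ∷_))
∑-+ (suc n) (suc k) f g =
  trans (cong₂ _+_ (∑-+ n (suc k) (f ∘ (outside ∷_)) (g ∘ (outside ∷_)))
                   (∑-+ n k (f ∘ (inside ∷_)) (g ∘ (inside ∷_))))
        (+-interchange (∑ n (suc k) (f ∘ (outside ∷_))) (∑ n (suc k) (g ∘ (outside ∷_)))
                     (∑ n k (f ∘ (inside ∷_))) (∑ n k (g ∘ (inside ∷_))))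

∑-* : ∀ n k a f → ∑ n k (λ S → a * f S) ≡ a * ∑ n k f
∑-* zero    zero    a f = refl
∑-* zero    (suc k) a f = sym (*-zeroʳ a)
∑-* (suc n) zero    a f = ∑-* n zero a (f ∘ (outside ∷_))
∑-* (suc n) (suc k) a f =
  trans (cong₂ _+_ (∑-* n (suc k) a (f ∘ (outside ∷_))) (∑-* n k a (f ∘ (inside ∷_))))
        (sym (*-distribˡ-+ a _ _))

∑-const : ∀ n k a → ∑ n k (const a) ≡ (n C k) * a
∑-const zero    zero    a = sym (+-identityʳ a)
∑-const zero    (suc k) a = refl
∑-const (suc n) zero    a = ∑-const n zero a
∑-const (suc n) (suc k) a =
  trans (cong₂ _+_ (∑-const n (suc k) a) (∑-const n k a))
  (trans (sym (*-distribʳ-+ a (n C suc k) (n C k)))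
         (cong (_* a) (trans (+-comm (n C suc k) (n C k)) (nCk+nC[k+1]≡[n+1]C[k+1] n k))))

conv-∑-zero : ∀ k (f : ℕ → ℕ → Subset 0 → ℕ) → conv k (λ i l → ∑ 0 (suc i) (f i l)) ≡ 0
conv-∑-zero k f = trans (conv-const k 0) (*-zeroʳ (suc k))

-- Vandermonde's identity with weights: a subset of a disjoint union is a pair of subsets of the two
-- parts. The weight `g` need not factor, as the induced tree depends on both parts.
∑-split : ∀ a b k (g : Subset a → Subset b → ℕ) →
          ∑ (a + b) k (λ S → g (take a S) (drop a S)) ≡
          conv k (λ i l → ∑ a i (λ S → ∑ b l (g S)))
∑-split zero    b zero    g = refl
∑-split zero    b (suc k) g =
  sym (trans (cong (∑ b (suc k) (g []) +_) (conv-∑-zero k λ i l S → ∑ b l (g S)))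
             (+-identityʳ _))
∑-split (suc a) b zero    g = ∑-split a b zero (g ∘ (outside ∷_))
∑-split (suc a) b (suc k) g =
  trans (cong₂ _+_ (∑-split a b (suc k) (g ∘ (outside ∷_))) (∑-split a b k (g ∘ (inside ∷_))))
  (trans (+-assoc (∑ a 0 (λ S → ∑ b (suc k) (g (outside ∷ S)))) _ _)
    (cong (∑ a 0 (λ S → ∑ b (suc k) (g (outside ∷ S))) +_)
      (sym (conv-+ k (λ i l → ∑ a (suc i) (λ S → ∑ b l (g (outside ∷ S))))
                     (λ i l → ∑ a i (λ S → ∑ b l (g (inside ∷ S))))))))

-- Counting induced trees

𝟙 : Bool → ℕ
𝟙 b = if b then 1 else 0

length-filter : ∀ {A : Set} {P : Pred A 0ℓ} (P? : Decidable P) xs →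
                length (filter P? xs) ≡ sum (map (𝟙 ∘ does ∘ P?) xs)
length-filter P? []       = refl
length-filter P? (x ∷ xs) with does (P? x)
... | true  = cong suc (length-filter P? xs)
... | false = length-filter P? xs

-- Connects the filtered enumeration that defines `c` with `∑`, where the cardinality is built into
-- the recursion.
sum-subsets : ∀ n k (q : Subset n → Bool) →
              sum (map (λ S → 𝟙 ((∣ S ∣ ≡ᵇ k) ∧ q S)) (subsets n)) ≡ ∑ n k (𝟙 ∘ q)
sum-subsets zero    zero    q = +-identityʳ _
sum-subsets zero    (suc k) q = refl
sum-subsets (suc n) k       q =
  trans (cong sum (map-++ (λ S → 𝟙 ((∣ S ∣ ≡ᵇ k) ∧ q S)) (map (outside ∷_) (subsets n)) (map (inside ∷_) (subsets n))))
  (trans (sum-++ (map (λ S → 𝟙 ((∣ S ∣ ≡ᵇ k) ∧ q S)) (map (outside ∷_) (subsets n))) _)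
  (trans (cong₂ _+_ (cong sum (sym (map-∘ (subsets n)))) (cong sum (sym (map-∘ (subsets n)))))
    (last k)))
  where
  zeros : ∀ {A : Set} (xs : List A) → sum (map (const 0) xs) ≡ 0
  zeros []       = refl
  zeros (x ∷ xs) = zeros xs
  last : ∀ k → sum (map (λ S → 𝟙 ((∣ S ∣ ≡ᵇ k) ∧ q (outside ∷ S))) (subsets n)) +
               sum (map (λ S → 𝟙 ((suc ∣ S ∣ ≡ᵇ k) ∧ q (inside ∷ S))) (subsets n)) ≡ ∑ (suc n) k (𝟙 ∘ q)
  last zero    = trans (cong₂ _+_ (sum-subsets n 0 (q ∘ (outside ∷_))) (zeros (subsets n))) (+-identityʳ _)
  last (suc k) = cong₂ _+_ (sum-subsets n (suc k) (q ∘ (outside ∷_))) (sum-subsets n k (q ∘ (inside ∷_)))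

-- The tree induced by a set of leaves, its children listed in the order of T.

induced : (T : Tree) → Subset (leaves T) → Maybe Tree
induced T S = Maybe.map suppress (span T S)

W : Tree → ℕ → (Maybe Tree → ℕ) → ℕ
W T k φ = ∑ (leaves T) k (φ ∘ induced T)

W* : List Tree → ℕ → (List Tree → ℕ) → ℕ
W* ts k φ = ∑ (leaves* ts) k (λ S → φ (suppress* (span* ts S)))

is : Tree → Maybe Tree → ℕ
is D nothing  = 0
is D (just X) = 𝟙 (does (X ≅? D))

is≤1 : ∀ D x → is D x ≤ 1
is≤1 D nothing = z≤n
is≤1 D (just X) with does (X ≅? D)
... | true  = s≤s z≤n
... | false = z≤n

c≡W : ∀ D T → c D T ≡ W T (leaves D) (is D)
c≡W D T =
  trans (length-filter (λ S → ∣ S ∣ ≟ leaves D ×-dec induces? T S D) (subsets (leaves T)))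
  -- `does` of a `×-dec` computes to `_∧_`, and `does (m ≟ n)` to `m ≡ᵇ n`, so the filter already
  -- has the form that `sum-subsets` expects.
  (trans (sum-subsets (leaves T) (leaves D) (λ S → does (induces? T S D)))
    (∑-cong (leaves T) (leaves D) λ S → does-induces (span T S)))
  where
  does-induces : ∀ U → 𝟙 (does (MaybeAny.dec (λ U → suppress U ≅? D) U)) ≡ is D (Maybe.map suppress U)
  does-induces nothing  = refl
  does-induces (just U) = refl

-- Suppression at a vertex depends only on how many branches meet the set: none, one (the vertex
-- disappears) or several. So the tree induced below a vertex is a function of the trees induced in
-- its branches.
join : List Tree → Maybe Tree
join []               = nothing
join (t ∷ [])         = just t
join ts@(_ ∷ _ ∷ _) = just (node ts)

induced-node : ∀ t ts S → induced (node (t ∷ ts)) S ≡ join (suppress* (span* (t ∷ ts) S))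
induced-node t ts S with span* (t ∷ ts) S
... | []        = refl
... | _ ∷ []    = refl
... | _ ∷ _ ∷ _ = refl

suppress*-fromMaybe : ∀ x ys → suppress* (fromMaybe x ++ ys) ≡ fromMaybe (Maybe.map suppress x) ++ suppress* ys
suppress*-fromMaybe nothing  ys = refl
suppress*-fromMaybe (just x) ys = refl

W-node : ∀ t ts k φ → W (node (t ∷ ts)) k φ ≡ W* (t ∷ ts) k (φ ∘ join)
W-node t ts k φ = ∑-cong (leaves* (t ∷ ts)) k λ S → cong φ (induced-node t ts S)

-- The weight of a tree `x` induced in the first branch once the leaves in the other branches are
-- summed out. It is again a function of an induced tree, which is why `W` admits arbitrary weights
-- and not just indicators.
rest : List Tree → ℕ → (List Tree → ℕ) → Maybe Tree → ℕ
rest ts l φ x = W* ts l (λ ys → φ (fromMaybe x ++ ys))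

W*-∷ : ∀ t ts k φ → W* (t ∷ ts) k φ ≡ conv k (λ i l → W t i (rest ts l φ))
W*-∷ t ts k φ =
  trans (∑-cong (leaves* (t ∷ ts)) k λ S → cong φ
          (suppress*-fromMaybe (span t (take (leaves t) S)) (span* ts (drop (leaves t) S))))
        (∑-split (leaves t) (leaves* ts) k
          (λ S S′ → φ (fromMaybe (induced t S) ++ suppress* (span* ts S′))))

-- Binomial coefficients

-- The absorption identity (k+1) C(n,k+1) = (n - k) C(n,k), written without subtraction.
[k+1]nC[k+1] : ∀ n k → suc k * (n C suc k) + k * (n C k) ≡ n * (n C k)
[k+1]nC[k+1] zero    zero    = refl
[k+1]nC[k+1] zero    (suc k) = cong₂ _+_ (*-zeroʳ (2 + k)) (*-zeroʳ (suc k))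
[k+1]nC[k+1] (suc n) zero    =
  trans (+-identityʳ _) (trans (*-identityˡ _) (trans (nC1≡n (suc n)) (sym (*-identityʳ (suc n)))))
[k+1]nC[k+1] (suc n) (suc k) = trans
  (cong₂ (λ x y → (2 + k) * x + suc k * y) (sym (nCk+nC[k+1]≡[n+1]C[k+1] n (suc k))) (sym (nCk+nC[k+1]≡[n+1]C[k+1] n k)))
  (trans (lemma n k (n C k) (n C suc k) (n C suc (suc k)) ([k+1]nC[k+1] n k) ([k+1]nC[k+1] n (suc k)))
  (cong (suc n *_) (nCk+nC[k+1]≡[n+1]C[k+1] n k)))
  where
  regroup : ∀ k x y z → (2 + k) * (y + z) + suc k * (x + y) ≡
            ((2 + k) * z + suc k * y) + ((suc k * y + k * x) + (x + y))
  regroup = solve-∀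
  regroup′ : ∀ n x y → n * y + (n * x + (x + y)) ≡ suc n * (x + y)
  regroup′ = solve-∀
  lemma : ∀ n k x y z → suc k * y + k * x ≡ n * x → (2 + k) * z + suc k * y ≡ n * y →
          (2 + k) * (y + z) + suc k * (x + y) ≡ suc n * (x + y)
  lemma n k x y z p q = trans (regroup k x y z)
    (trans (cong₂ (λ a b → a + (b + (x + y))) q p) (regroup′ n x y))

nC[k+1]≤n*nCk : ∀ n k → n C suc k ≤ n * (n C k)
nC[k+1]≤n*nCk n k = begin
  n C suc k                          ≤⟨ m≤m+n (n C suc k) (k * (n C suc k)) ⟩
  suc k * (n C suc k)                ≤⟨ m≤m+n _ (k * (n C k)) ⟩
  suc k * (n C suc k) + k * (n C k)  ≡⟨ [k+1]nC[k+1] n k ⟩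
  n * (n C k)                        ∎
  where open ≤-Reasoning

nCk≤n^k : ∀ n k → n C k ≤ n ^ k
nCk≤n^k n zero    = ≤-refl
nCk≤n^k n (suc k) = ≤-trans (nC[k+1]≤n*nCk n k) (*-monoʳ-≤ n (nCk≤n^k n k))

nCk>0 : ∀ {n k} → k ≤ n → 0 < n C k
nCk>0 {n}     {zero}  _       = s≤s z≤n
nCk>0 {suc n} {suc k} (s≤s p) = subst (0 <_) (nCk+nC[k+1]≡[n+1]C[k+1] n k)
  (≤-trans (nCk>0 p) (m≤m+n (n C k) _))

-- C(n,k)/n^k = ∏ (1 − i/n)/k! increases with n.

nCk*q^k≤qCk*n^k : ∀ {n q} k → n ≤ q → (n C k) * q ^ k ≤ (q C k) * n ^ k
nCk*q^k≤qCk*n^k {n} {q} zero n≤q = ≤-refl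
nCk*q^k≤qCk*n^k {n} {q} (suc k) n≤q = [ low , high ]′ (<-≤-connex k n)
  where
  high : n ≤ k → (n C suc k) * q ^ suc k ≤ (q C suc k) * n ^ suc k
  high n≤k = subst (λ x → x * q ^ suc k ≤ (q C suc k) * n ^ suc k)
                 (sym (k>n⇒nCk≡0 (s≤s n≤k))) z≤n
  step : ∀ n u → n ≡ k + u → suc k * (n C suc k) ≡ u * (n C k)
  step n u refl = +-cancelʳ-≡ (k * (n C k)) _ _
    (trans ([k+1]nC[k+1] n k) (trans (*-distribʳ-+ (n C k) k u) (+-comm (k * (n C k)) _)))
  expand : ∀ k u v → (u + v) * (k + u) ≡ u * (k + u + v) + v * k
  expand = solve-∀
  -- With n = k + u and q = n + v, absorption turns the step from `k` to `k + 1` into the factors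
  -- u/n and (u + v)/q, which are compared here.
  cross : ∀ k u v → u * (k + u + v) ≤ (u + v) * (k + u)
  cross k u v = ≤-trans (m≤m+n _ (v * k)) (≤-reflexive (sym (expand k u v)))
  low : k < n → (n C suc k) * q ^ suc k ≤ (q C suc k) * n ^ suc k
  low k<n with m≤n⇒∃[o]m+o≡n (<⇒≤ k<n) | m≤n⇒∃[o]m+o≡n n≤q
  ... | u , refl | v , refl = *-cancelˡ-≤ (suc k) (begin
      suc k * (((k + u) C suc k) * q′ ^ suc k)   ≡⟨ *-assoc (suc k) ((k + u) C suc k) _ ⟨
      suc k * ((k + u) C suc k) * q′ ^ suc k     ≡⟨ cong (_* q′ ^ suc k) (step (k + u) u refl) ⟩
      u * A′ * (q′ * q′ ^ k)                   ≡⟨ *-interchange u A′ q′ (q′ ^ k) ⟩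
      u * q′ * (A′ * q′ ^ k)                   ≤⟨ *-mono-≤ (cross k u v) (nCk*q^k≤qCk*n^k k n≤q) ⟩
      (u + v) * (k + u) * (B′ * (k + u) ^ k)   ≡⟨ *-interchange (u + v) B′ (k + u) ((k + u) ^ k) ⟨
      (u + v) * B′ * (k + u) ^ suc k           ≡⟨ cong (_* (k + u) ^ suc k) (step q′ (u + v) (+-assoc k u v)) ⟨
      suc k * (q′ C suc k) * (k + u) ^ suc k   ≡⟨ *-assoc (suc k) (q′ C suc k) _ ⟩
      suc k * ((q′ C suc k) * (k + u) ^ suc k) ∎)
    where
    open ≤-Reasoning
    q′ = k + u + v
    A′ = (k + u) C k
    B′ = q′ C k

-- Monotonicity taken from `k` to `n`, where `k C k` is 1. It converts errors of order `n ^ k` into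
-- multiples of the binomial coefficient.
n^k≤k^k*nCk : ∀ {n k} → k ≤ n → n ^ k ≤ k ^ k * (n C k)
n^k≤k^k*nCk {n} {k} k≤n = subst₂ _≤_
  (trans (cong (_* n ^ k) (nCn≡1 k)) (*-identityˡ (n ^ k))) (*-comm (n C k) (k ^ k))
  (nCk*q^k≤qCk*n^k k k≤n)

-- In effect C(nl,k) ≤ l^k (C(n,k) + n^(k-1)). Absorption carries both sides from `k` to `k + 1`;
-- the leftover k C(n,k) ≤ k n^k merges with the error term into a multiple of k + 1, which cancels.
n*[nl]Ck≤ : ∀ n l k → n * (n * l C k) ≤ l ^ k * (n * (n C k) + n ^ k)
n*[nl]Ck≤ n l zero = ≤-trans (m≤m+n (n * 1) 1) (≤-reflexive (sym (+-identityʳ _)))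
n*[nl]Ck≤ n l (suc k) = *-cancelˡ-≤ (suc k) (begin
  suc k * (n * (n * l C suc k))                           ≡⟨ x∙yz≈y∙xz (suc k) n (n * l C suc k) ⟩
  n * (suc k * (n * l C suc k))                           ≤⟨ *-monoʳ-≤ n (m≤m+n _ (k * (n * l C k))) ⟩
  n * (suc k * (n * l C suc k) + k * (n * l C k))         ≡⟨ cong (n *_) ([k+1]nC[k+1] (n * l) k) ⟩
  n * (n * l * (n * l C k))                               ≡⟨ x∙yz≈y∙xz n (n * l) (n * l C k) ⟩
  n * l * (n * (n * l C k))                               ≤⟨ *-monoʳ-≤ (n * l) (n*[nl]Ck≤ n l k) ⟩
  n * l * (l ^ k * (n * (n C k) + n ^ k))                 ≡⟨ regroup n l (l ^ k) (n C k) (n ^ k) ⟩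
  l * l ^ k * (n * (n * (n C k)) + n * n ^ k)             ≡⟨ cong (λ x → l * l ^ k * (n * x + n * n ^ k)) ([k+1]nC[k+1] n k) ⟨
  l * l ^ k * (n * (suc k * (n C suc k) + k * (n C k)) + n * n ^ k)
    ≡⟨ regroup′ (l * l ^ k) n k (n C suc k) (n C k) (n * n ^ k) ⟩
  l * l ^ k * (suc k * (n * (n C suc k)) + (k * (n * (n C k)) + n * n ^ k))
    ≤⟨ *-monoʳ-≤ (l * l ^ k) (+-monoʳ-≤ (suc k * (n * (n C suc k))) (+-monoˡ-≤ (n * n ^ k) (*-monoʳ-≤ k (*-monoʳ-≤ n (nCk≤n^k n k))))) ⟩
  l * l ^ k * (suc k * (n * (n C suc k)) + (k * (n * n ^ k) + n * n ^ k))
    ≡⟨ regroup″ (l * l ^ k) k (n * (n C suc k)) (n * n ^ k) ⟩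
  suc k * (l * l ^ k * (n * (n C suc k) + n * n ^ k))     ∎)
  where
  open ≤-Reasoning
  regroup : ∀ n l a x y → n * l * (a * (n * x + y)) ≡ l * a * (n * (n * x) + n * y)
  regroup = solve-∀
  regroup′ : ∀ a n k x y z → a * (n * (suc k * x + k * y) + z) ≡ a * (suc k * (n * x) + (k * (n * y) + z))
  regroup′ = solve-∀
  regroup″ : ∀ a k x y → a * (suc k * x + (k * y + y)) ≡ suc k * (a * (x + y))
  regroup″ = solve-∀

∑≤ : ∀ n k {f b} → (∀ S → f S ≤ b) → ∑ n k f ≤ n ^ k * b
∑≤ n k {b = b} f≤b = ≤-trans (∑-mono n k f≤b)
  (≤-trans (≤-reflexive (∑-const n k b)) (*-monoˡ-≤ b (nCk≤n^k n k)))

W≤ : ∀ T k {φ b} → (∀ x → φ x ≤ b) → W T k φ ≤ leaves T ^ k * b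
W≤ T k φ≤b = ∑≤ (leaves T) k (φ≤b ∘ induced T)

W*≤ : ∀ ts k {φ b} → (∀ xs → φ xs ≤ b) → W* ts k φ ≤ leaves* ts ^ k * b
W*≤ ts k φ≤b = ∑≤ (leaves* ts) k (λ S → φ≤b (suppress* (span* ts S)))

-- Grafting

mutual
  graft : Tree → Tree → Tree
  graft U (node [])       = U
  graft U (node (t ∷ ts)) = node (graft* U (t ∷ ts))

  graft* : Tree → List Tree → List Tree
  graft* U []       = []
  graft* U (t ∷ ts) = graft U t ∷ graft* U ts

mutual
  leaves-graft : ∀ U T → leaves (graft U T) ≡ leaves T * leaves U
  leaves-graft U (node [])       = sym (+-identityʳ (leaves U))
  leaves-graft U (node (t ∷ ts)) = leaves*-graft* U (t ∷ ts)

  leaves*-graft* : ∀ U ts → leaves* (graft* U ts) ≡ leaves* ts * leaves U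
  leaves*-graft* U []       = refl
  leaves*-graft* U (t ∷ ts) = trans (cong₂ _+_ (leaves-graft U t) (leaves*-graft* U ts))
    (sym (*-distribʳ-+ (leaves U) (leaves t) (leaves* ts)))

length-graft* : ∀ U ts → length (graft* U ts) ≡ length ts
length-graft* U []       = refl
length-graft* U (t ∷ ts) = cong suc (length-graft* U ts)

mutual
  graft-dary : ∀ {d U T} → IsDary d U → IsDary d T → IsDary d (graft U T)
  graft-dary                  u leaf                           = u
  graft-dary {d} {U} u (internal {ts@(_ ∷ _)} p q r) =
    internal (subst (2 ≤_) (sym (length-graft* U ts)) p) (subst (_≤ d) (sym (length-graft* U ts)) q) (graft*-dary u r)

  graft*-dary : ∀ {d U ts} → IsDary d U → All (IsDary d) ts → All (IsDary d) (graft* U ts)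
  graft*-dary u []       = []
  graft*-dary u (r ∷ rs) = graft-dary u r ∷ graft*-dary u rs

-- Sets of at most two leaves

just-leaf : Maybe Tree
just-leaf = just (node [])

mutual
  W-0 : ∀ T φ → W T 0 φ ≡ φ nothing
  W-0 (node [])       φ = refl
  W-0 (node (t ∷ ts)) φ = trans (W-node t ts 0 φ) (W*-0 (t ∷ ts) (φ ∘ join))

  W*-0 : ∀ ts φ → W* ts 0 φ ≡ φ []
  W*-0 []       φ = refl
  W*-0 (t ∷ ts) φ = trans (W*-∷ t ts 0 φ) (trans (W-0 t (rest ts 0 φ)) (W*-0 ts φ))

mutual
  W-1 : ∀ T φ → W T 1 φ ≡ leaves T * φ just-leaf
  W-1 (node [])       φ = sym (+-identityʳ _)
  W-1 (node (t ∷ ts)) φ = trans (W-node t ts 1 φ) (W*-1 (t ∷ ts) (φ ∘ join))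

  W*-1 : ∀ ts φ → W* ts 1 φ ≡ leaves* ts * φ (node [] ∷ [])
  W*-1 []       φ = refl
  W*-1 (t ∷ ts) φ = trans (W*-∷ t ts 1 φ) (trans
    (cong₂ _+_ (trans (W-0 t (rest ts 1 φ)) (W*-1 ts φ)) (trans (W-1 t (rest ts 0 φ)) (cong (leaves t *_) (W*-0 ts (λ ys → φ (node [] ∷ ys))))))
    (trans (+-comm (leaves* ts * φ (node [] ∷ [])) _)
           (sym (*-distribʳ-+ (φ (node [] ∷ [])) (leaves t) (leaves* ts)))))

cherry : Tree
cherry = node (node [] ∷ node [] ∷ [])

mutual
  -- Every pair of leaves induces a cherry, so the count is C(L,2) times its weight, L being the
  -- number of leaves; doubling and moving the linear term avoid division and subtraction.
  W-2 : ∀ T φ → 2 * W T 2 φ + leaves T * φ (just cherry) ≡ leaves T * leaves T * φ (just cherry)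
  W-2 (node [])       φ = refl
  W-2 (node (t ∷ ts)) φ = trans (cong (λ w → 2 * w + leaves* (t ∷ ts) * φ (just cherry)) (W-node t ts 2 φ))
                                (W*-2 (t ∷ ts) (φ ∘ join) refl)

  -- Two leaves of a forest induce two single leaves or one cherry; the hypothesis gives both the
  -- same weight, which for `φ ∘ join` holds by computation.
  W*-2 : ∀ ts φ → φ (node [] ∷ node [] ∷ []) ≡ φ (cherry ∷ []) →
         2 * W* ts 2 φ + leaves* ts * φ (cherry ∷ []) ≡ leaves* ts * leaves* ts * φ (cherry ∷ [])
  W*-2 []       φ eq = refl
  W*-2 (t ∷ ts) φ eq = trans
    (cong (λ w → 2 * w + (leaves t + leaves* ts) * φ (cherry ∷ []))
      (trans (W*-∷ t ts 2 φ) (cong₂ _+_ (W-0 t (rest ts 2 φ)) (cong₂ _+_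
        (trans (W-1 t (rest ts 1 φ)) (cong (leaves t *_) (trans (W*-1 ts (λ ys → φ (node [] ∷ ys))) (cong (leaves* ts *_) eq)))) refl))))
    (square (leaves t) (leaves* ts) (φ (cherry ∷ []))
      (W* ts 2 φ) (W t 2 φ′)
      (W*-2 ts φ eq)
      (subst (λ v → 2 * W t 2 φ′ + leaves t * v ≡ leaves t * leaves t * v) (W*-0 ts (λ ys → φ (cherry ∷ ys))) (W-2 t φ′)))
    where
    φ′ : Maybe Tree → ℕ
    φ′ = rest ts 0 φ
    regroup : ∀ a b v x y → 2 * (x + (a * (b * v) + y)) + (a + b) * v ≡
              (2 * x + b * v) + (2 * y + a * v) + 2 * (a * (b * v))
    regroup = solve-∀
    regroup′ : ∀ a b v → b * b * v + a * a * v + 2 * (a * (b * v)) ≡ (a + b) * (a + b) * v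
    regroup′ = solve-∀
    square : ∀ a b v x y → 2 * x + b * v ≡ b * b * v → 2 * y + a * v ≡ a * a * v →
             2 * (x + (a * (b * v) + y)) + (a + b) * v ≡ (a + b) * (a + b) * v
    square a b v x y p q = trans (regroup a b v x y)
      (trans (cong₂ (λ s t → s + t + 2 * (a * (b * v))) p q) (regroup′ a b v))

-- Counts in grafted trees

^-*-conv : ∀ {i l k} x → i + l ≡ k → x ^ k ≡ x ^ i * x ^ l
^-*-conv {i} {l} x refl = ^-distribˡ-+-* x i l

mutual
  -- Choosing one leaf in the copy of `U` at each of `k` leaves of `T` gives `leaves U ^ k` sets
  -- that all induce the same tree as the original set. Sets with two leaves in one copy are
  -- discarded.
  W-graft : ∀ U T k φ → leaves U ^ k * W T k φ ≤ W (graft U T) k φ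
  W-graft U (node []) zero          φ = ≤-reflexive (trans (+-identityʳ _) (sym (W-0 U φ)))
  W-graft U (node []) (suc zero)    φ = ≤-reflexive (trans
    (cong₂ _*_ (*-identityʳ (leaves U)) refl) (sym (W-1 U φ)))
  W-graft U (node []) (suc (suc k)) φ = ≤-trans (≤-reflexive (*-zeroʳ (leaves U ^ (2 + k)))) z≤n
  W-graft U (node (t ∷ ts)) k φ = subst₂ _≤_
    (cong (leaves U ^ k *_) (sym (W-node t ts k φ))) (sym (W-node (graft U t) (graft* U ts) k φ))
    (W*-graft* U (t ∷ ts) k (φ ∘ join))

  W*-graft* : ∀ U ts k φ → leaves U ^ k * W* ts k φ ≤ W* (graft* U ts) k φ
  W*-graft* U []       zero    φ = ≤-reflexive (+-identityʳ _)
  W*-graft* U []       (suc k) φ = ≤-reflexive (*-zeroʳ (leaves U ^ suc k))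
  W*-graft* U (t ∷ ts) k φ = begin
    L ^ k * W* (t ∷ ts) k φ                                 ≡⟨ cong (L ^ k *_) (W*-∷ t ts k φ) ⟩
    L ^ k * conv k (λ i l → W t i (rest ts l φ))
      ≡⟨ conv-* k (L ^ k) _ ⟨
    conv k (λ i l → L ^ k * W t i (rest ts l φ))
      ≤⟨ conv-mono k step ⟩
    conv k (λ i l → W (graft U t) i (rest (graft* U ts) l φ))
      ≡⟨ W*-∷ (graft U t) (graft* U ts) k φ ⟨
    W* (graft* U (t ∷ ts)) k φ                              ∎
    where
    open ≤-Reasoning
    L = leaves U
    step : ∀ i l → i + l ≡ k →
           L ^ k * W t i (rest ts l φ) ≤
           W (graft U t) i (rest (graft* U ts) l φ)
    step i l eq = begin
      L ^ k * W t i ψ                     ≡⟨ cong (_* W t i ψ) (^-*-conv {i} {l} L eq) ⟩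
      L ^ i * L ^ l * W t i ψ             ≡⟨ *-assoc (L ^ i) (L ^ l) (W t i ψ) ⟩
      L ^ i * (L ^ l * W t i ψ)           ≡⟨ cong (L ^ i *_) (∑-* (leaves t) i (L ^ l) _) ⟨
      L ^ i * W t i (λ x → L ^ l * ψ x)   ≤⟨ *-monoʳ-≤ (L ^ i) (∑-mono (leaves t) i (λ S → W*-graft* U ts l (λ ys → φ (fromMaybe (induced t S) ++ ys)))) ⟩
      L ^ i * W t i ψ′                    ≤⟨ W-graft U t i ψ′ ⟩
      W (graft U t) i ψ′                  ∎
      where
      ψ ψ′ : Maybe Tree → ℕ
      ψ  = rest ts l φ
      ψ′ = rest (graft* U ts) l φ

-- Propagation of errors

-- A product rule for errors: the error of the first tree times the trivial bound N ^ l for the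
-- others, plus the trivial bound N ^ i for the first times the error of the others.
forestError : ℕ → (Tree → ℕ → ℕ) → List Tree → ℕ → ℕ
forestError N ε []       k = 0
forestError N ε (t ∷ ts) k = conv k (λ i l → ε t i * N ^ l + N ^ i * forestError N ε ts l)

module _ (N Q : ℕ) where

  -- (N/Q)^k W K k φ ≤ W t k φ + ε t k b without division.  The bound b is needed as
  -- the proof for forests takes φ to be a sum over sets of leaves of the other trees.

  Dominated : (Tree → ℕ → ℕ) → Tree → ℕ → Tree → Set
  Dominated ε K m t = ∀ k → k ≤ m → ∀ φ b → (∀ x → φ x ≤ b) →
    N ^ k * W K k φ ≤ Q ^ k * (W t k φ + ε t k * b)

  -- The copies of `K` are exchanged for the actual trees one at a time: first in the rest of the
  -- forest, for each set chosen in the first copy, and then the first copy itself, with the count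
  -- in the rest as its weight.
  W*-dominated : ∀ {ε K m} ts → leaves K ≤ Q → leaves* ts ≤ N → All (Dominated ε K m) ts →
                 ∀ k → k ≤ m → ∀ φ b → (∀ xs → φ xs ≤ b) →
                 N ^ k * W* (replicate (length ts) K) k φ ≤
                 Q ^ k * (W* ts k φ + forestError N ε ts k * b)
  W*-dominated []       K≤Q ts≤N [] zero    k≤m φ b φ≤b = ≤-reflexive
    (cong (_+ 0) (sym (+-identityʳ (φ []))))
  W*-dominated []       K≤Q ts≤N [] (suc k) k≤m φ b φ≤b = ≤-trans (≤-reflexive (*-zeroʳ (N ^ suc k))) z≤n
  W*-dominated {ε} {K} {m} (t ∷ ts) K≤Q ts≤N (p ∷ ps) k k≤m φ b φ≤b = begin
    N ^ k * W* (K ∷ Ks) k φ                              ≡⟨ cong (N ^ k *_) (W*-∷ K Ks k φ) ⟩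
    N ^ k * conv k (λ i l → W K i (rest Ks l φ))
      ≡⟨ conv-* k (N ^ k) _ ⟨
    conv k (λ i l → N ^ k * W K i (rest Ks l φ))
      ≤⟨ conv-mono k step ⟩
    conv k (λ i l → Q ^ k * (W t i (rest ts l φ) + b * e i l))
      ≡⟨ conv-* k (Q ^ k) _ ⟩
    Q ^ k * conv k (λ i l → W t i (rest ts l φ) + b * e i l)
      ≡⟨ cong (Q ^ k *_) (conv-+ k _ _) ⟩
    Q ^ k * (conv k (λ i l → W t i (rest ts l φ)) + conv k (λ i l → b * e i l))
      ≡⟨ cong (Q ^ k *_) (cong₂ _+_ (sym (W*-∷ t ts k φ)) (trans (conv-* k b e) (*-comm b _))) ⟩
    Q ^ k * (W* (t ∷ ts) k φ + forestError N ε (t ∷ ts) k * b)  ∎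
    where
    open ≤-Reasoning
    Ks = replicate (length ts) K
    e : ℕ → ℕ → ℕ
    e i l = ε t i * N ^ l + N ^ i * forestError N ε ts l
    step : ∀ i l → i + l ≡ k →
           N ^ k * W K i (rest Ks l φ) ≤
           Q ^ k * (W t i (rest ts l φ) + b * e i l)
    step i l eq = begin
      N ^ k * W K i ψK                          ≡⟨ cong (_* W K i ψK) (^-*-conv {i} {l} N eq) ⟩
      N ^ i * N ^ l * W K i ψK                  ≡⟨ *-assoc (N ^ i) (N ^ l) (W K i ψK) ⟩
      N ^ i * (N ^ l * W K i ψK)                ≡⟨ cong (N ^ i *_) (∑-* (leaves K) i (N ^ l) _) ⟨
      N ^ i * W K i (λ x → N ^ l * ψK x)
        ≤⟨ *-monoʳ-≤ (N ^ i) (∑-mono (leaves K) i (λ S →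
             W*-dominated ts K≤Q (m+n≤o⇒n≤o (leaves t) ts≤N) ps l
               (≤-trans (m+n≤o⇒n≤o i (≤-reflexive eq)) k≤m) (λ ys → φ (fromMaybe (induced K S) ++ ys)) b
               (λ ys → φ≤b (fromMaybe (induced K S) ++ ys)))) ⟩
      N ^ i * W K i (λ x → Q ^ l * (ψ x + E * b))
        ≡⟨ cong (N ^ i *_) (trans (∑-* (leaves K) i (Q ^ l) _)
             (cong (Q ^ l *_) (trans (∑-+ (leaves K) i _ _) (cong (W K i ψ +_) (∑-const (leaves K) i (E * b)))))) ⟩
      N ^ i * (Q ^ l * (W K i ψ + (leaves K C i) * (E * b)))
        ≡⟨ regroup (N ^ i) (Q ^ l) (W K i ψ) _ ⟩
      Q ^ l * (N ^ i * W K i ψ + N ^ i * ((leaves K C i) * (E * b)))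
        ≤⟨ *-monoʳ-≤ (Q ^ l) (+-mono-≤
             (p i (≤-trans (m+n≤o⇒m≤o i (≤-reflexive eq)) k≤m) ψ (N ^ l * b)
               -- The weight `ψ` sums over at most N ^ l sets, hence the new bound N ^ l * b.
               (λ x → ≤-trans (W*≤ ts l (λ ys → φ≤b (fromMaybe x ++ ys))) (*-monoˡ-≤ b (^-monoˡ-≤ l (m+n≤o⇒n≤o (leaves t) ts≤N)))))
             (*-monoʳ-≤ (N ^ i) (*-monoˡ-≤ (E * b) (≤-trans (nCk≤n^k (leaves K) i) (^-monoˡ-≤ i K≤Q))))) ⟩
      Q ^ l * (Q ^ i * (W t i ψ + ε t i * (N ^ l * b)) + N ^ i * (Q ^ i * (E * b)))
        ≡⟨ regroup′ (Q ^ l) (Q ^ i) (W t i ψ) (ε t i) (N ^ l) b (N ^ i) E ⟩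
      Q ^ i * Q ^ l * (W t i ψ + b * e i l)     ≡⟨ cong (_* (W t i ψ + b * e i l)) (^-*-conv {i} {l} Q eq) ⟨
      Q ^ k * (W t i ψ + b * e i l)             ∎
      where
      E = forestError N ε ts l
      ψK ψ : Maybe Tree → ℕ
      ψK = rest Ks l φ
      ψ  = rest ts l φ
      regroup : ∀ a q w z → a * (q * (w + z)) ≡ q * (a * w + a * z)
      regroup = solve-∀
      regroup′ : ∀ ql qi w e nl b ni E →
                 ql * (qi * (w + e * (nl * b)) + ni * (qi * (E * b))) ≡ qi * ql * (w + b * (e * nl + ni * E))
      regroup′ = solve-∀

-- An error of relative order 1/N in a count of order N^k.  For k = 0 there is none,
-- as the empty set is counted exactly.

error : ℕ → ℕ → ℕ → ℕ
error a N zero    = 0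
error a N (suc k) = a * N ^ k

error-*-^ : ∀ a N i l → error a N i * N ^ l ≤ error a N (i + l)
error-*-^ a N zero    l = z≤n
error-*-^ a N (suc i) l = ≤-reflexive
  (trans (*-assoc a (N ^ i) (N ^ l)) (cong (a *_) (sym (^-distribˡ-+-* N i l))))

^-*-error : ∀ a N i l → N ^ i * error a N l ≤ error a N (i + l)
^-*-error a N i l = subst₂ _≤_ (*-comm (error a N l) (N ^ i)) (cong (error a N) (+-comm l i)) (error-*-^ a N l i)

error-+ : ∀ a b N k → error a N k + error b N k ≡ error (a + b) N k
error-+ a b N zero    = refl
error-+ a b N (suc k) = sym (*-distribʳ-+ (N ^ k) a b)

error-* : ∀ a b N k → a * error b N k ≡ error (a * b) N k
error-* a b N zero    = *-zeroʳ a
error-* a b N (suc k) = sym (*-assoc a b (N ^ k))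

error-mono : ∀ {a b M N} k → a ≤ b → M ≤ N → error a M k ≤ error b N k
error-mono zero    a≤b M≤N = z≤n
error-mono (suc k) a≤b M≤N = *-mono-≤ a≤b (^-monoˡ-≤ k M≤N)

N*error≤ : ∀ a N k → N * error a N k ≤ a * N ^ k
N*error≤ a N zero    = ≤-trans (≤-reflexive (*-zeroʳ N)) z≤n
N*error≤ a N (suc k) = ≤-reflexive (x∙yz≈y∙xz N a (N ^ k))

-- The error constant of a forest of `r` trees with constant `a` each: every one of at most m + 1
-- terms of the convolution costs `a` for the first tree plus the constant of the remaining ones.
lowCoef : ℕ → ℕ → ℕ → ℕ
lowCoef m a zero    = 0
lowCoef m a (suc r) = suc m * (a + lowCoef m a r)

-- Collects only the mixed terms, with chosen leaves both in the first tree and in later ones; the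
-- errors of top order are kept apart.
topCoef : ℕ → ℕ → ℕ → ℕ
topCoef m a zero    = 0
topCoef m a (suc r) = suc m * (a + lowCoef m a r) + topCoef m a r

module _ (N : ℕ) (ε : Tree → ℕ → ℕ) (m a : ℕ) where

  LowError : Tree → Set
  LowError t = ∀ k → k ≤ m → ε t k ≤ error a N k

  term≤ : ∀ t ts k i l → i + l ≡ k → i ≤ m → LowError t →
          forestError N ε ts l ≤ error (lowCoef m a (length ts)) N l →
          ε t i * N ^ l + N ^ i * forestError N ε ts l ≤ error (a + lowCoef m a (length ts)) N k
  term≤ t ts k i l refl i≤m low E≤ = begin
    ε t i * N ^ l + N ^ i * forestError N ε ts l  ≤⟨ +-mono-≤ (*-monoˡ-≤ (N ^ l) (low i i≤m)) (*-monoʳ-≤ (N ^ i) E≤) ⟩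
    error a N i * N ^ l + N ^ i * error g N l           ≤⟨ +-mono-≤ (error-*-^ a N i l) (^-*-error g N i l) ⟩
    error a N (i + l) + error g N (i + l)               ≡⟨ error-+ a g N (i + l) ⟩
    error (a + g) N (i + l)                          ∎
    where
    open ≤-Reasoning
    g = lowCoef m a (length ts)

  forestError-low : ∀ ts → All LowError ts → ∀ k → k ≤ m →
                    forestError N ε ts k ≤ error (lowCoef m a (length ts)) N k
  forestError-low []       []       zero    k≤m = z≤n
  forestError-low []       []       (suc k) k≤m = z≤n
  forestError-low (t ∷ ts) (p ∷ ps) k k≤m = begin
    forestError N ε (t ∷ ts) k
      ≤⟨ conv-mono k (λ i l eq → term≤ t ts k i l eq (≤-trans (m+n≤o⇒m≤o i (≤-reflexive eq)) k≤m) p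
           (forestError-low ts ps l (≤-trans (m+n≤o⇒n≤o i (≤-reflexive eq)) k≤m))) ⟩
    conv k (λ _ _ → error (a + lowCoef m a (length ts)) N k)    ≡⟨ conv-const k _ ⟩
    suc k * error (a + lowCoef m a (length ts)) N k             ≤⟨ *-monoˡ-≤ (error (a + lowCoef m a (length ts)) N k) (s≤s k≤m) ⟩
    suc m * error (a + lowCoef m a (length ts)) N k             ≡⟨ error-* (suc m) _ N k ⟩
    error (lowCoef m a (length (t ∷ ts))) N k                   ∎
    where open ≤-Reasoning

-- Only the terms of the convolution that put all m + 2 leaves into one tree
-- involve errors of the top order; these have coefficient 1.

forestError-top : ∀ N ε m a ts → All (LowError N ε (suc m) a) ts →
                  forestError N ε ts (2 + m) ≤
                  sum (map (λ t → ε t (2 + m)) ts) + topCoef (suc m) a (length ts) * N ^ suc m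
forestError-top N ε m a []       []       = z≤n
forestError-top N ε m a (t ∷ ts) (p ∷ ps) = begin
  f 0 (2 + m) + conv (suc m) (λ i → f (suc i))
    ≡⟨ cong (f 0 (2 + m) +_) (conv-last m (λ i → f (suc i))) ⟩
  f 0 (2 + m) + (conv m (λ i l → f (suc i) (suc l)) + f (2 + m) 0)
    ≤⟨ +-mono-≤ first (+-mono-≤ middle last) ⟩
  forestError N ε ts (2 + m) + (suc (suc m) * (error (a + g) N (2 + m)) + ε t (2 + m))
    ≤⟨ +-monoˡ-≤ _ (forestError-top N ε m a ts ps) ⟩
  (sum (map (λ t → ε t (2 + m)) ts) + topCoef (suc m) a (length ts) * N ^ suc m) +
  (suc (suc m) * (error (a + g) N (2 + m)) + ε t (2 + m))
    ≡⟨ regroup (sum (map (λ t → ε t (2 + m)) ts)) (topCoef (suc m) a (length ts)) (N ^ suc m) (suc (suc m)) (a + g) (ε t (2 + m)) ⟩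
  ε t (2 + m) + sum (map (λ t → ε t (2 + m)) ts) +
  (suc (suc m) * (a + g) + topCoef (suc m) a (length ts)) * N ^ suc m ∎
  where
  open ≤-Reasoning
  g = lowCoef (suc m) a (length ts)
  f : ℕ → ℕ → ℕ
  f i l = ε t i * N ^ l + N ^ i * forestError N ε ts l
  low = forestError-low N ε (suc m) a ts ps
  -- An empty choice carries no error, so here only the error of the other trees remains, and in
  -- `last` only that of `t`.
  first : f 0 (2 + m) ≤ forestError N ε ts (2 + m)
  first = ≤-trans (+-monoˡ-≤ _ (*-monoˡ-≤ (N ^ (2 + m)) (p 0 z≤n))) (≤-reflexive (*-identityˡ _))
  last : f (2 + m) 0 ≤ ε t (2 + m)
  last = begin
    ε t (2 + m) * 1 + N ^ (2 + m) * forestError N ε ts 0  ≤⟨ +-monoʳ-≤ _ (*-monoʳ-≤ (N ^ (2 + m)) (low 0 z≤n)) ⟩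
    ε t (2 + m) * 1 + N ^ (2 + m) * 0                     ≡⟨ cong₂ _+_ (*-identityʳ (ε t (2 + m))) (*-zeroʳ (N ^ (2 + m))) ⟩
    ε t (2 + m) + 0                                       ≡⟨ +-identityʳ _ ⟩
    ε t (2 + m)                                           ∎
  middle : conv m (λ i l → f (suc i) (suc l)) ≤ suc (suc m) * error (a + g) N (2 + m)
  middle = begin
    conv m (λ i l → f (suc i) (suc l))
      ≤⟨ conv-mono m (λ i l eq → term≤ N ε (suc m) a t ts (2 + m) (suc i) (suc l)
           (cong suc (trans (+-suc i l) (cong suc eq))) (s≤s (m+n≤o⇒m≤o i (≤-reflexive eq))) p
           (low (suc l) (s≤s (m+n≤o⇒n≤o i (≤-reflexive eq))))) ⟩
    conv m (λ _ _ → error (a + g) N (2 + m))    ≡⟨ conv-const m _ ⟩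
    suc m * error (a + g) N (2 + m)             ≤⟨ *-monoˡ-≤ (error (a + g) N (2 + m)) (n≤1+n (suc m)) ⟩
    suc (suc m) * error (a + g) N (2 + m)       ∎
  regroup : ∀ S T x k c e → (S + T * x) + (k * (c * x) + e) ≡ e + S + (k * c + T) * x
  regroup = solve-∀

sum-map-mono : ∀ {A : Set} {f g : A → ℕ} {xs} → All (λ x → f x ≤ g x) xs → sum (map f xs) ≤ sum (map g xs)
sum-map-mono []       = z≤n
sum-map-mono (p ∷ ps) = +-mono-≤ p (sum-map-mono ps)

leaves*-++ : ∀ ts us → leaves* (ts ++ us) ≡ leaves* ts + leaves* us
leaves*-++ []       us = refl
leaves*-++ (t ∷ ts) us = trans (cong (leaves t +_) (leaves*-++ ts us)) (sym (+-assoc (leaves t) _ _))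

leaves*-replicate : ∀ r t → leaves* (replicate r t) ≡ r * leaves t
leaves*-replicate zero    t = refl
leaves*-replicate (suc r) t = cong (leaves t +_) (leaves*-replicate r t)

leaves-node : ∀ ts → 0 < length ts → leaves (node ts) ≡ leaves* ts
leaves-node (t ∷ ts) _ = refl

W-node⁺ : ∀ ts k φ → 0 < length ts → W (node ts) k φ ≡ W* ts k (φ ∘ join)
W-node⁺ (t ∷ ts) k φ _ = W-node t ts k φ

^-distribʳ-* : ∀ k m n → (m * n) ^ k ≡ m ^ k * n ^ k
^-distribʳ-* zero    m n = refl
^-distribʳ-* (suc k) m n = trans (cong (m * n *_) (^-distribʳ-* k m n)) (*-interchange m n (m ^ k) (n ^ k))

-- Even d-ary trees

module Even (p : ℕ) .{{_ : NonTrivial (suc p)}} where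

  d : ℕ
  d = suc p

  1≤p : 1 ≤ p
  1≤p = s≤s⁻¹ (nonTrivial⇒n>1 d)

  children : ℕ → List Tree
  children m = replicate (d ∸ m % d) (H d (m / d)) ++ replicate (m % d) (H d (suc (m / d)))

  m%d≤d : ∀ m → m % d ≤ d
  m%d≤d m = <⇒≤ (m%n<n m d)

  length-children : ∀ m → length (children m) ≡ d
  length-children m = trans (length-++ (replicate (d ∸ m % d) (H d (m / d))))
    (trans (cong₂ _+_ (length-replicate (d ∸ m % d)) (length-replicate (m % d))) (m∸n+n≡m (m%d≤d m)))

  children-nonempty : ∀ m → 0 < length (children m)
  children-nonempty m = subst (0 <_) (sym (length-children m)) (s≤s z≤n)

  replicate⁺ : ∀ {P : Tree → Set} b {t} → (0 < b → P t) → All P (replicate b t)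
  replicate⁺ zero    p = []
  replicate⁺ (suc b) p = All.replicate⁺ (suc b) (p (s≤s z≤n))

  -- The second premise is conditional because without remainder no copy of `H d (suc (m / d))`
  -- occurs, and its index need not be below `suc m`: for m = 0 it equals 1.
  All-children : ∀ {P : Tree → Set} m → P (H d (m / d)) → (0 < m % d → P (H d (suc (m / d)))) → All P (children m)
  All-children m x y = All.++⁺ (All.replicate⁺ (d ∸ m % d) x) (replicate⁺ (m % d) y)

  suc[m/d]≤m : ∀ m → 0 < m % d → suc (m / d) ≤ m
  suc[m/d]≤m m 0<b = begin
    1 + m / d             ≤⟨ +-mono-≤ 0<b (m≤m*n (m / d) d) ⟩
    m % d + m / d * d     ≡⟨ m≡m%n+[m/n]*n m d ⟨
    m                     ∎
    where open ≤-Reasoning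

  H-induction : (P : Tree → Set) → P (node []) → (∀ m → All P (children m) → P (node (children m))) → ∀ n → P (H d n)
  H-induction P base step = <-rec (λ n → P (H d n)) go
    where
    go : ∀ n → (∀ {m} → m < n → P (H d m)) → P (H d n)
    go zero    rec = base
    go (suc m) rec = subst P (sym (H-suc d m)) (step m
      (All-children m (rec (s≤s (m/n≤m m d))) (λ 0<b → rec (s≤s (suc[m/d]≤m m 0<b)))))

  H-strictlyDary : ∀ n → IsStrictlyDary d (H d n)
  H-strictlyDary = H-induction (IsStrictlyDary d) leaf (λ m r → internal (length-children m) r)

  leaves*-children : ∀ m → leaves* (children m) ≡
                     (d ∸ m % d) * leaves (H d (m / d)) + m % d * leaves (H d (suc (m / d)))
  leaves*-children m = trans (leaves*-++ (replicate (d ∸ m % d) (H d (m / d))) _)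
    (cong₂ _+_ (leaves*-replicate (d ∸ m % d) _) (leaves*-replicate (m % d) _))

  leaves-H : ∀ n → leaves (H d n) ≡ p * n + 1
  leaves-H = <-rec (λ n → leaves (H d n) ≡ p * n + 1) go
    where
    weigh : ∀ b {x y} → (0 < b → x ≡ y) → b * x ≡ b * y
    weigh zero    eq = refl
    weigh (suc b) eq = cong (suc b *_) (eq (s≤s z≤n))
    total : ∀ a b p s → a + b ≡ suc p → a * (p * s + 1) + b * (p * suc s + 1) ≡ p * suc (b + s * suc p) + 1
    total a b p s eq = trans (regroup a b p s) (trans (cong (λ c → c * (p * s + 1) + b * p) eq) (regroup′ b p s))
      where
      regroup : ∀ a b p s → a * (p * s + 1) + b * (p * suc s + 1) ≡ (a + b) * (p * s + 1) + b * p
      regroup = solve-∀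
      regroup′ : ∀ b p s → suc p * (p * s + 1) + b * p ≡ p * suc (b + s * suc p) + 1
      regroup′ = solve-∀
    go : ∀ n → (∀ {m} → m < n → leaves (H d m) ≡ p * m + 1) → leaves (H d n) ≡ p * n + 1
    go zero    rec = cong (_+ 1) (sym (*-zeroʳ p))
    go (suc m) rec = begin
      leaves (H d (suc m))                                     ≡⟨ cong leaves (H-suc d m) ⟩
      leaves (node (children m))                               ≡⟨ leaves-node (children m) (children-nonempty m) ⟩
      leaves* (children m)                                     ≡⟨ leaves*-children m ⟩
      (d ∸ b) * leaves (H d s) + b * leaves (H d (suc s))
        ≡⟨ cong₂ _+_ (cong ((d ∸ b) *_) (rec (s≤s (m/n≤m m d)))) (weigh b λ 0<b → rec (s≤s (suc[m/d]≤m m 0<b))) ⟩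
      (d ∸ b) * (p * s + 1) + b * (p * suc s + 1)              ≡⟨ total (d ∸ b) b p s (m∸n+n≡m (m%d≤d m)) ⟩
      p * suc (b + s * d) + 1                                  ≡⟨ cong (λ m → p * suc m + 1) (m≡m%n+[m/n]*n m d) ⟨
      p * suc m + 1                                            ∎
      where
      open ≡-Reasoning
      s = m / d
      b = m % d

  -- Sizes of the branches

  -- `small` makes the errors of the branches contract when they are summed; `large` keeps N/d
  -- within an additive constant above the size of a branch.
  record Child (N : ℕ) (t : Tree) : Set where
    field
      index    : ℕ
      isH      : t ≡ H d index
      small    : 3 * leaves t ≤ 2 * N
      large    : N ≤ d * (leaves t + p)

  -- If the smaller branches have x leaves, the larger ones have x + p, and N = d x + b p.
  children-Child : ∀ m → All (Child (leaves* (children m))) (children m)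
  children-Child m = All-children m
    (record { index = s ; isH = refl ; small = small₁ ; large = large₁ })
    (λ 0<b → record { index = suc s ; isH = refl ; small = small₂ 0<b ; large = ≤-trans large₁ (*-monoʳ-≤ d (+-monoˡ-≤ p x≤y)) })
    where
    open ≤-Reasoning
    s b x y N : ℕ
    s = m / d
    b = m % d
    x = leaves (H d s)
    y = leaves (H d (suc s))
    N = leaves* (children m)
    y≡x+p : y ≡ x + p
    y≡x+p = trans (leaves-H (suc s)) (trans (shift p s) (cong (_+ p) (sym (leaves-H s))))
      where
      shift : ∀ p s → p * suc s + 1 ≡ p * s + 1 + p
      shift = solve-∀
    x≤y : x ≤ y
    x≤y = ≤-trans (m≤m+n x p) (≤-reflexive (sym y≡x+p))
    N≡ : N ≡ d * x + b * p
    N≡ = trans (leaves*-children m) (trans (cong (λ y → (d ∸ b) * x + b * y) y≡x+p)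
      (trans (regroup (d ∸ b) b x p) (cong (λ c → c * x + b * p) (m∸n+n≡m (m%d≤d m)))))
      where
      regroup : ∀ a b x p → a * x + b * (x + p) ≡ (a + b) * x + b * p
      regroup = solve-∀
    large₁ : N ≤ d * (x + p)
    large₁ = begin
      N                  ≡⟨ N≡ ⟩
      d * x + b * p      ≤⟨ +-monoʳ-≤ (d * x) (*-monoˡ-≤ p (m%d≤d m)) ⟩
      d * x + d * p      ≡⟨ *-distribˡ-+ d x p ⟨
      d * (x + p)        ∎
    small₁ : 3 * x ≤ 2 * N
    small₁ = begin
      3 * x              ≤⟨ m≤m+n (3 * x) x ⟩
      3 * x + x          ≡⟨ regroup x ⟩
      2 * (2 * x)        ≤⟨ *-monoʳ-≤ 2 (*-monoˡ-≤ x (s≤s 1≤p)) ⟩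
      2 * (d * x)        ≤⟨ *-monoʳ-≤ 2 (m≤m+n (d * x) (b * p)) ⟩
      2 * (d * x + b * p) ≡⟨ cong (2 *_) N≡ ⟨
      2 * N              ∎
      where
      regroup : ∀ x → 3 * x + x ≡ 2 * (2 * x)
      regroup = solve-∀
    small₂ : 0 < b → 3 * y ≤ 2 * N
    small₂ 0<b = begin
      3 * y                    ≡⟨ cong (3 *_) y≡x+p ⟩
      3 * (x + p)              ≤⟨ bound p x 1≤p (leaves>0 (H d s)) ⟩
      2 * (d * x + 1 * p)      ≤⟨ *-monoʳ-≤ 2 (+-monoʳ-≤ (d * x) (*-monoˡ-≤ p 0<b)) ⟩
      2 * (d * x + b * p)      ≡⟨ cong (2 *_) N≡ ⟨
      2 * N                    ∎
      where
      -- The slack vanishes only for d = 2 and a smaller branch of one leaf; for N = 3 the larger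
      -- branch then carries exactly two thirds of the leaves.
      slack : ∀ p x → 2 * ((2 + p) * suc x + 1 * suc p) ≡ 3 * (suc x + suc p) + (p + x + 2 * (p * x))
      slack = solve-∀
      bound : ∀ p x → 0 < p → 0 < x → 3 * (x + p) ≤ 2 * (suc p * x + 1 * p)
      bound (suc p) (suc x) _ _ = ≤-trans (m≤m+n _ (p + x + 2 * (p * x))) (≤-reflexive (sym (slack p x)))

  -- Complete trees

  -- In closed form (d^h - 1)/(d - 1). At these indices every division in the recursion for `H`
  -- leaves remainder 0, and they are unbounded, so the limit density can be tested on complete
  -- trees alone.
  completeIndex : ℕ → ℕ
  completeIndex zero    = 0
  completeIndex (suc h) = suc (completeIndex h * d)

  K : ℕ → Tree
  K h = H d (completeIndex h)

  K-suc : ∀ h → K (suc h) ≡ node (replicate d (K h))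
  K-suc h = trans (H-suc d (completeIndex h * d)) (cong node (trans
    (cong₂ (λ b s → replicate (d ∸ b) (H d s) ++ replicate b (H d (suc s)))
      (m*n%n≡0 (completeIndex h) d) (m*n/n≡m (completeIndex h) d))
    (++-identityʳ (replicate d (K h)))))

  leaves-K : ∀ h → leaves (K h) ≡ d ^ h
  leaves-K zero    = refl
  leaves-K (suc h) = trans (cong leaves (K-suc h))
    (trans (leaves*-replicate d (K h)) (cong (d *_) (leaves-K h)))

  h≤completeIndex : ∀ h → h ≤ completeIndex h
  h≤completeIndex zero    = z≤n
  h≤completeIndex (suc h) = s≤s (≤-trans (h≤completeIndex h) (m≤m*n (completeIndex h) d))

  -- Comparison of even trees with complete trees

  shiftCoef : ℕ → ℕ
  shiftCoef zero    = 0
  shiftCoef (suc k) = p + d * shiftCoef k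

  shiftCoef-mono : ∀ {k m} → k ≤ m → shiftCoef k ≤ shiftCoef m
  shiftCoef-mono z≤n       = z≤n
  shiftCoef-mono (s≤s k≤m) = +-monoʳ-≤ p (*-monoʳ-≤ d (shiftCoef-mono k≤m))

  -- In the product (x + p)(x^k + e) the part p x^k is at most p N^k, and e gets multiplied by x + p
  -- ≤ d N; this yields the recursion for `shiftCoef`.
  [x+p]^k≤ : ∀ {x N} k → 0 < N → x ≤ N → (x + p) ^ k ≤ x ^ k + error (shiftCoef k) N k
  [x+p]^k≤ zero    0<N x≤N = ≤-refl
  [x+p]^k≤ {x} {N} (suc k) 0<N x≤N = begin
    (x + p) * (x + p) ^ k                  ≤⟨ *-monoʳ-≤ (x + p) ([x+p]^k≤ k 0<N x≤N) ⟩
    (x + p) * (x ^ k + e)                  ≡⟨ expand x p (x ^ k) e ⟩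
    x * x ^ k + (p * x ^ k + (x + p) * e)
      ≤⟨ +-monoʳ-≤ (x * x ^ k) (+-mono-≤ (*-monoʳ-≤ p (^-monoˡ-≤ k x≤N)) (*-monoˡ-≤ e x+p≤dN)) ⟩
    x * x ^ k + (p * N ^ k + d * N * e)
      ≤⟨ +-monoʳ-≤ (x * x ^ k) (+-monoʳ-≤ (p * N ^ k) (≤-trans (≤-reflexive (*-assoc d N e)) (*-monoʳ-≤ d (N*error≤ (shiftCoef k) N k)))) ⟩
    x * x ^ k + (p * N ^ k + d * (shiftCoef k * N ^ k))
      ≡⟨ cong (x * x ^ k +_) (regroup p d (shiftCoef k) (N ^ k)) ⟩
    x * x ^ k + (p + d * shiftCoef k) * N ^ k ∎
    where
    open ≤-Reasoning
    e = error (shiftCoef k) N k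
    expand : ∀ x p y e → (x + p) * (y + e) ≡ x * y + (p * y + (x + p) * e)
    expand = solve-∀
    regroup : ∀ p d s z → p * z + d * (s * z) ≡ (p + d * s) * z
    regroup = solve-∀
    x+p≤dN : x + p ≤ d * N
    x+p≤dN = +-mono-≤ x≤N (m≤m*n p N {{>-nonZero 0<N}})

  -- Chosen so that two thirds of `coef k`, the d shifts of the branches and the mixed terms
  -- together stay within `coef k`: hence the factor 3. The summand of the preceding order makes
  -- `coef` increasing.
  coef : ℕ → ℕ
  coef 0 = 0
  coef 1 = 0
  coef 2 = 1
  coef (suc (suc (suc m))) = coef (suc (suc m)) +
    3 * (d * shiftCoef (3 + m) + topCoef (2 + m) (coef (suc (suc m)) + shiftCoef (2 + m)) d)

  coef-≤suc : ∀ k → coef k ≤ coef (suc k)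
  coef-≤suc 0 = z≤n
  coef-≤suc 1 = z≤n
  coef-≤suc (suc (suc m)) = m≤m+n (coef (2 + m)) _

  coef-mono : ∀ {k m} → k ≤ m → coef k ≤ coef m
  coef-mono {k} {m} k≤m with m≤n⇒∃[o]m+o≡n k≤m
  ... | o , refl = go o
    where
    go : ∀ o → coef k ≤ coef (k + o)
    go zero    = ≤-reflexive (cong coef (sym (+-identityʳ k)))
    go (suc o) = ≤-trans (go o) (≤-trans (coef-≤suc (k + o)) (≤-reflexive (cong coef (sym (+-suc k o)))))

  Bound : ℕ → ℕ → ℕ → Set
  Bound k h n = ∀ φ b → (∀ x → φ x ≤ b) →
    leaves (H d n) ^ k * W (K h) k φ ≤ (d ^ h) ^ k * (W (H d n) k φ + error (coef k) (leaves (H d n)) k * b)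

  -- Two sources of error: the inductive bound for the branch, and the deviation of its size from
  -- N/d.
  childError : ℕ → Tree → ℕ → ℕ
  childError N t k = error (coef k) (leaves t) k + error (shiftCoef k) N k

  -- For a branch with x leaves, N ≤ d (x + p), so N^k is at most d^k times x^k plus a term of lower
  -- order. The main term falls to the induction hypothesis, the other to the trivial bound on the
  -- count in `K h`.
  child-Dominated : ∀ {N h m t} → (∀ k → k ≤ m → ∀ n → Bound k h n) → 0 < N → leaves t ≤ N → Child N t →
                    Dominated N (d * d ^ h) (childError N) (K h) m t
  child-Dominated {N} {h} {m} {t} IH 0<N t≤N child k k≤m φ b φ≤b = begin
    N ^ k * w                              ≤⟨ *-monoˡ-≤ w (^-monoˡ-≤ k large) ⟩
    (d * (x + p)) ^ k * w                  ≡⟨ cong (_* w) (^-distribʳ-* k d (x + p)) ⟩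
    d ^ k * (x + p) ^ k * w                ≡⟨ *-assoc (d ^ k) _ w ⟩
    d ^ k * ((x + p) ^ k * w)              ≤⟨ *-monoʳ-≤ (d ^ k) (*-monoˡ-≤ w ([x+p]^k≤ k 0<N t≤N)) ⟩
    d ^ k * ((x ^ k + s) * w)              ≡⟨ cong (d ^ k *_) (*-distribʳ-+ w (x ^ k) s) ⟩
    d ^ k * (x ^ k * w + s * w)            ≤⟨ *-monoʳ-≤ (d ^ k) (+-mono-≤ bound (*-monoʳ-≤ s w≤)) ⟩
    d ^ k * (q ^ k * (W t k φ + e * b) + s * (q ^ k * b))
      ≡⟨ regroup (d ^ k) (q ^ k) (W t k φ) e s b ⟩
    d ^ k * q ^ k * (W t k φ + (e + s) * b)  ≡⟨ cong (_* (W t k φ + (e + s) * b)) (^-distribʳ-* k d q) ⟨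
    (d * q) ^ k * (W t k φ + (e + s) * b)    ∎
    where
    open ≤-Reasoning
    open Child child
    x = leaves t
    q = d ^ h
    w = W (K h) k φ
    s = error (shiftCoef k) N k
    e = error (coef k) x k
    w≤ : w ≤ q ^ k * b
    w≤ = subst (λ q → w ≤ q ^ k * b) (leaves-K h) (W≤ (K h) k φ≤b)
    bound : x ^ k * w ≤ q ^ k * (W t k φ + e * b)
    bound = subst (λ t → leaves t ^ k * w ≤ q ^ k * (W t k φ + error (coef k) (leaves t) k * b)) (sym isH)
              (IH k k≤m index φ b φ≤b)
    regroup : ∀ D Q w e s b → D * (Q * (w + e * b) + s * (Q * b)) ≡ D * Q * (w + (e + s) * b)
    regroup = solve-∀

  bound-0 : ∀ h n → Bound 0 h n
  bound-0 h n φ b φ≤b = ≤-reflexive (cong (_+ 0)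
    (trans (W-0 (K h) φ) (trans (sym (W-0 (H d n) φ)) (sym (+-identityʳ _)))))

  bound-1 : ∀ h n → Bound 1 h n
  bound-1 h n φ b φ≤b = ≤-reflexive (trans
    (cong (leaves (H d n) * 1 *_) (trans (W-1 (K h) φ) (cong (_* φ just-leaf) (leaves-K h))))
    (trans (swap (leaves (H d n)) (d ^ h) (φ just-leaf))
      (cong (d ^ h * 1 *_) (trans (sym (W-1 (H d n) φ)) (sym (+-identityʳ _))))))
    where
    swap : ∀ N q v → N * 1 * (q * v) ≡ q * 1 * (N * v)
    swap = solve-∀

  -- At this order the weights (Nᵢ/N)^(k-1) add up to 1, so the recursive estimate would not
  -- contract; the exact count `W-2` replaces it.
  bound-2 : ∀ h n → Bound 2 h n
  bound-2 h n φ b φ≤b = *-cancelˡ-≤ 2 (begin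
    2 * (N ^ 2 * wK)                       ≡⟨ regroup (N ^ 2) wK ⟩
    N ^ 2 * (2 * wK)                       ≤⟨ *-monoʳ-≤ (N ^ 2) (m≤m+n (2 * wK) (q * v)) ⟩
    N ^ 2 * (2 * wK + q * v)
      ≡⟨ cong (N ^ 2 *_) (subst (λ q → 2 * wK + q * v ≡ q * q * v) (leaves-K h) (W-2 (K h) φ)) ⟩
    N ^ 2 * (q * q * v)                    ≡⟨ regroup′ N q v ⟩
    q ^ 2 * (N * N * v)                    ≡⟨ cong (q ^ 2 *_) (W-2 (H d n) φ) ⟨
    q ^ 2 * (2 * wH + N * v)
      ≤⟨ *-monoʳ-≤ (q ^ 2) (+-monoʳ-≤ (2 * wH) (≤-trans (*-monoʳ-≤ N (φ≤b (just cherry))) (m≤n*m (N * b) 2))) ⟩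
    q ^ 2 * (2 * wH + 2 * (N * b))         ≡⟨ regroup″ (q ^ 2) wH N b ⟩
    2 * (q ^ 2 * (wH + 1 * (N * 1) * b))   ∎)
    where
    open ≤-Reasoning
    N = leaves (H d n)
    q = d ^ h
    wK = W (K h) 2 φ
    wH = W (H d n) 2 φ
    v = φ (just cherry)
    regroup : ∀ x y → 2 * (x * y) ≡ x * (2 * y)
    regroup = solve-∀
    regroup′ : ∀ N q v → N * (N * 1) * (q * q * v) ≡ q * (q * 1) * (N * N * v)
    regroup′ = solve-∀
    regroup″ : ∀ z w N b → z * (2 * w + 2 * (N * b)) ≡ 2 * (z * (w + 1 * (N * 1) * b))
    regroup″ = solve-∀

  coef>0 : ∀ m → 0 < coef (2 + m)
  coef>0 m = coef-mono {2} {2 + m} (s≤s (s≤s z≤n))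

  sum-leaves : ∀ A s ts → sum (map (λ t → A * leaves t + s) ts) ≡ A * leaves* ts + length ts * s
  sum-leaves A s []       = trans (sym (*-zeroʳ A)) (sym (+-identityʳ _))
  sum-leaves A s (t ∷ ts) = trans (cong (A * leaves t + s +_) (sum-leaves A s ts))
    (regroup A (leaves t) s (leaves* ts) (length ts))
    where
    regroup : ∀ A x s y r → A * x + s + (A * y + r * s) ≡ A * (x + y) + suc r * s
    regroup = solve-∀

  leaves≤ : ∀ ts → All (λ t → leaves t ≤ leaves* ts) ts
  leaves≤ ts = leaves≤leaves* ts ≤-refl

  -- As no child carries more than two thirds of the N leaves, the errors of order k
  -- of the children add up to at most two thirds of coef k * N ^ (k − 1).

  children-error : ∀ m j →
    forestError (leaves* (children j)) (childError (leaves* (children j))) (children j) (3 + m) ≤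
    error (coef (3 + m)) (leaves* (children j)) (3 + m)
  children-error m j = *-cancelˡ-≤ 3 (begin
    3 * forestError N ε ts (3 + m)
      ≤⟨ *-monoʳ-≤ 3 (forestError-top N ε (suc m) a ts low) ⟩
    3 * (sum (map (λ t → ε t (3 + m)) ts) + T * N ^ (2 + m))
      ≡⟨ *-distribˡ-+ 3 (sum (map (λ t → ε t (3 + m)) ts)) _ ⟩
    3 * sum (map (λ t → ε t (3 + m)) ts) + 3 * (T * N ^ (2 + m))
      ≤⟨ +-monoˡ-≤ (3 * (T * N ^ (2 + m))) leading ⟩
    (A * (2 * N * N ^ m) * N + length ts * (3 * (s * N ^ (2 + m)))) + 3 * (T * N ^ (2 + m))
      ≡⟨ cong (λ r → (A * (2 * N * N ^ m) * N + r * (3 * (s * N ^ (2 + m)))) + 3 * (topCoef (2 + m) a r * N ^ (2 + m))) (length-children j) ⟩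
    (A * (2 * N * N ^ m) * N + d * (3 * (s * N ^ (2 + m)))) + 3 * (T′ * N ^ (2 + m))
      ≡⟨ regroup A N (N ^ m) d s T′ ⟩
    (2 * A + 3 * (d * s + T′)) * N ^ (2 + m)
      -- By the choice of `coef`, the shifts and mixed terms fit into the remaining third of 3 * A.
      ≤⟨ *-monoˡ-≤ (N ^ (2 + m)) (+-monoʳ-≤ (2 * A) (m≤n+m (3 * (d * s + T′)) (coef (2 + m)))) ⟩
    (2 * A + A) * N ^ (2 + m)
      ≡⟨ regroup′ A (N ^ (2 + m)) ⟩
    3 * (A * N ^ (2 + m)) ∎)
    where
    open ≤-Reasoning
    ts = children j
    N A s a T T′ : ℕ
    N  = leaves* ts
    A  = coef (3 + m)
    s  = shiftCoef (3 + m)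
    a  = coef (2 + m) + shiftCoef (2 + m)
    T  = topCoef (2 + m) a (length ts)
    T′ = topCoef (2 + m) a d
    ε  = childError N
    low : All (LowError N ε (2 + m) a) ts
    low = All.map (λ {t} t≤N k k≤m → ≤-trans
      (+-mono-≤ (error-mono k (coef-mono k≤m) t≤N) (error-mono k (shiftCoef-mono k≤m) ≤-refl))
      (≤-reflexive (error-+ (coef (2 + m)) (shiftCoef (2 + m)) N k))) (leaves≤ ts)
    cubic : ∀ A x z s → 3 * (A * (x * (x * z)) + s) ≡ A * (3 * x * z) * x + 3 * s
    cubic = solve-∀
    leading : 3 * sum (map (λ t → ε t (3 + m)) ts) ≤ A * (2 * N * N ^ m) * N + length ts * (3 * (s * N ^ (2 + m)))
    leading = begin
      3 * sum (map (λ t → ε t (3 + m)) ts)     ≡⟨ sum-3* ts ⟩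
      sum (map (λ t → 3 * ε t (3 + m)) ts)
        ≤⟨ sum-map-mono (All.zipWith (λ { {t} (child , t≤N) → each t child t≤N }) (children-Child j , leaves≤ ts)) ⟩
      sum (map (λ t → A * (2 * N * N ^ m) * leaves t + 3 * (s * N ^ (2 + m))) ts)
        ≡⟨ sum-leaves (A * (2 * N * N ^ m)) (3 * (s * N ^ (2 + m))) ts ⟩
      A * (2 * N * N ^ m) * N + length ts * (3 * (s * N ^ (2 + m))) ∎
      where
      sum-3* : ∀ ts → 3 * sum (map (λ t → ε t (3 + m)) ts) ≡ sum (map (λ t → 3 * ε t (3 + m)) ts)
      sum-3* []       = refl
      sum-3* (t ∷ ts) = trans (*-distribˡ-+ 3 (ε t (3 + m)) _) (cong (3 * ε t (3 + m) +_) (sum-3* ts))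
      -- One factor `leaves t` is bounded by 2N/3 and `m` of them by N; the last is kept, so that
      -- summing over the children yields N.
      each : ∀ t → Child N t → leaves t ≤ N →
             3 * ε t (3 + m) ≤ A * (2 * N * N ^ m) * leaves t + 3 * (s * N ^ (2 + m))
      each t child t≤N = begin
        3 * (A * leaves t ^ (2 + m) + s * N ^ (2 + m))
          ≡⟨ cubic A (leaves t) (leaves t ^ m) (s * N ^ (2 + m)) ⟩
        A * (3 * leaves t * leaves t ^ m) * leaves t + 3 * (s * N ^ (2 + m))
          ≤⟨ +-monoˡ-≤ (3 * (s * N ^ (2 + m))) (*-monoˡ-≤ (leaves t) (*-monoʳ-≤ A (*-mono-≤ (Child.small child) (^-monoˡ-≤ m t≤N)))) ⟩
        A * (2 * N * N ^ m) * leaves t + 3 * (s * N ^ (2 + m)) ∎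
    regroup : ∀ A N z d s T → (A * (2 * N * z) * N + d * (3 * (s * (N * (N * z))))) + 3 * (T * (N * (N * z))) ≡
              (2 * A + 3 * (d * s + T)) * (N * (N * z))
    regroup = solve-∀
    regroup′ : ∀ A z → (2 * A + A) * z ≡ 3 * (A * z)
    regroup′ = solve-∀

  -- Induction on the height at fixed order: `K (suc h)` and `H d (suc j)` both have d branches,
  -- which are compared at height `h`; `W*-dominated` joins these comparisons. A single leaf `K 0`
  -- has no set of three leaves.
  bound-step : ∀ m → (∀ k → k ≤ 2 + m → ∀ h n → Bound k h n) → ∀ h n → Bound (3 + m) h n
  bound-step m low zero    n φ b φ≤b = ≤-trans (≤-reflexive (*-zeroʳ (leaves (H d n) ^ (3 + m)))) z≤n
  -- `H d 0` is a single leaf; since `coef` is positive, the error term alone covers the trivial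
  -- bound for `K (suc h)`.
  bound-step m low (suc h) zero φ b φ≤b = begin
    1 ^ k * W (K (suc h)) k φ              ≡⟨ cong (_* W (K (suc h)) k φ) (^-zeroˡ k) ⟩
    1 * W (K (suc h)) k φ                  ≡⟨ *-identityˡ _ ⟩
    W (K (suc h)) k φ                      ≤⟨ W≤ (K (suc h)) k φ≤b ⟩
    leaves (K (suc h)) ^ k * b             ≡⟨ cong (λ q → q ^ k * b) (leaves-K (suc h)) ⟩
    (d ^ suc h) ^ k * b
      ≤⟨ *-monoʳ-≤ ((d ^ suc h) ^ k) (≤-trans (≤-reflexive (sym (*-identityˡ b))) (*-monoˡ-≤ b 1≤error)) ⟩
    (d ^ suc h) ^ k * (error (coef k) 1 k * b) ∎
    where
    open ≤-Reasoning
    k = 3 + m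
    1≤error : 1 ≤ error (coef k) 1 k
    1≤error = subst (1 ≤_) (sym (trans (cong (coef k *_) (^-zeroˡ (2 + m))) (*-identityʳ (coef k)))) (coef>0 (suc m))
  bound-step m low (suc h) (suc j) φ b φ≤b = subst
    (λ T → leaves T ^ k * W (K (suc h)) k φ ≤ (d ^ suc h) ^ k * (W T k φ + error (coef k) (leaves T) k * b))
    (sym (H-suc d j)) (subst (λ N → N ^ k * W (K (suc h)) k φ ≤ (d ^ suc h) ^ k * (W (node ts) k φ + error (coef k) N k * b))
      (sym (leaves-node ts (children-nonempty j))) (begin
    N ^ k * W (K (suc h)) k φ                    ≡⟨ cong (λ T → N ^ k * W T k φ) (K-suc h) ⟩
    N ^ k * W (node (replicate d (K h))) k φ     ≡⟨ cong (N ^ k *_) (W-node⁺ (replicate d (K h)) k φ (s≤s z≤n)) ⟩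
    N ^ k * W* (replicate d (K h)) k (φ ∘ join)
      ≡⟨ cong (λ r → N ^ k * W* (replicate r (K h)) k (φ ∘ join)) (length-children j) ⟨
    N ^ k * W* (replicate (length ts) (K h)) k (φ ∘ join)
      ≤⟨ W*-dominated N (d ^ suc h) ts (≤-trans (≤-reflexive (leaves-K h)) (m≤n*m (d ^ h) d)) ≤-refl dominated
           k ≤-refl (φ ∘ join) b (φ≤b ∘ join) ⟩
    (d ^ suc h) ^ k * (W* ts k (φ ∘ join) + forestError N (childError N) ts k * b)
      ≡⟨ cong (λ w → (d ^ suc h) ^ k * (w + forestError N (childError N) ts k * b)) (W-node⁺ ts k φ (children-nonempty j)) ⟨
    (d ^ suc h) ^ k * (W (node ts) k φ + forestError N (childError N) ts k * b)
      ≤⟨ *-monoʳ-≤ ((d ^ suc h) ^ k) (+-monoʳ-≤ (W (node ts) k φ) (*-monoˡ-≤ b (children-error m j))) ⟩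
    (d ^ suc h) ^ k * (W (node ts) k φ + error (coef k) N k * b) ∎))
    where
    open ≤-Reasoning
    k = 3 + m
    ts = children j
    N = leaves* ts
    -- Orders below `k` come from `low`; order `k` itself is available at the smaller height, for
    -- every `n`.
    all : ∀ i → i ≤ k → ∀ n → Bound i h n
    all i i≤k with m≤n⇒m<n∨m≡n i≤k
    ... | inj₁ i<k  = low i (s≤s⁻¹ i<k) h
    ... | inj₂ refl = bound-step m low h
    0<N : 0 < N
    0<N = subst (0 <_) (leaves-node ts (children-nonempty j)) (leaves>0 (node ts))
    dominated : All (Dominated N (d ^ suc h) (childError N) (K h) k) ts
    dominated = All.zipWith (λ { {t} (child , t≤N) → child-Dominated {N} {h} {k} {t} all 0<N t≤N child })
                  (children-Child j , leaves≤ ts)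

  bounds : ∀ m k → k ≤ m → ∀ h n → Bound k h n
  bounds m 0 _ = bound-0
  bounds m 1 _ = bound-1
  bounds m 2 _ = bound-2
  bounds (suc (suc (suc m))) (suc (suc (suc k))) (s≤s k≤m) =
    bound-step k (λ i i≤k → bounds (suc (suc m)) i (≤-trans i≤k k≤m))
  bounds (suc zero) (suc (suc (suc k))) (s≤s ())
  bounds (suc (suc zero)) (suc (suc (suc k))) (s≤s (s≤s ()))

  bound : ∀ k h n → Bound k h n
  bound k = bounds k k ≤-refl

-- Densities

-- An error z/N is at most z/n. This lets bounds in the number of leaves be stated in terms of a
-- smaller index.
rescale : ∀ {n N x y} z → n ≤ N → N * x ≤ N * y + z → n * x ≤ n * y + z
rescale {n} {N} {x} {y} z n≤N l with ≤-total x y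
... | inj₁ x≤y = ≤-trans (*-monoʳ-≤ n x≤y) (m≤m+n (n * y) z)
... | inj₂ y≤x with m≤n⇒∃[o]m+o≡n y≤x
...   | w , refl = ≤-trans (≤-reflexive (*-distribˡ-+ n y w)) (+-monoʳ-≤ (n * y)
        (≤-trans (*-monoˡ-≤ w n≤N) (+-cancelˡ-≤ (N * y) _ _ (≤-trans (≤-reflexive (sym (*-distribˡ-+ N y w))) l))))

ratio-≤ᵘ : ∀ a m b n x j → suc j * (a * suc n) ≤ suc j * (b * suc m) + x * (suc m * suc n) →
           ℚᵘ.mkℚᵘ (ℤ.+ a) m ℚᵘ.≤ ℚᵘ.mkℚᵘ (ℤ.+ b) n ℚᵘ.+ ℚᵘ.mkℚᵘ (ℤ.+ x) 0 ℚᵘ.* ℚᵘ.mkℚᵘ (ℤ.+ 1) j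
ratio-≤ᵘ a m b n x j l = ℚᵘ.*≤* (subst₂ ℤ._≤_
  (ℤ.pos-* a (suc n * (1 * suc j)))
  (trans (ℤ.pos-* (b * (1 * suc j) + x * 1 * suc n) (suc m)) (cong (ℤ._* ℤ.+ suc m)
    (trans (ℤ.pos-+ (b * (1 * suc j)) (x * 1 * suc n)) (cong₂ ℤ._+_ (ℤ.pos-* b (1 * suc j))
      (trans (ℤ.pos-* (x * 1) (suc n)) (cong (ℤ._* ℤ.+ suc n) (ℤ.pos-* x 1)))))))
  (ℤ.+≤+ (subst₂ _≤_ (regroup (suc j) a (suc n)) (regroup′ (suc j) b (suc m) x (suc n)) l)))
  where
  regroup : ∀ j a n → j * (a * n) ≡ a * (n * (1 * j))
  regroup = solve-∀
  regroup′ : ∀ j b m x n → j * (b * m) + x * (m * n) ≡ (b * (1 * j) + x * 1 * n) * m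
  regroup′ = solve-∀

ratio-≤ : ∀ {a m b n} x j .{{_ : NonZero j}} → 0 < m → 0 < n →
          j * (a * n) ≤ j * (b * m) + x * (m * n) →
          ratio a m ℚ.≤ ratio b n ℚ.+ (ℤ.+ x ℚ./ 1) ℚ.* (ℤ.+ 1 ℚ./ j)
ratio-≤ {a} {suc m} {b} {suc n} x (suc j) _ _ l = ℚ.toℚᵘ-cancel-≤ (begin
  ℚ.toℚᵘ (ℤ.+ a ℚ./ suc m)                                  ≃⟨ ℚ.toℚᵘ-fromℚᵘ (ℚᵘ.mkℚᵘ (ℤ.+ a) m) ⟩
  ℚᵘ.mkℚᵘ (ℤ.+ a) m                                         ≤⟨ ratio-≤ᵘ a m b n x j l ⟩
  ℚᵘ.mkℚᵘ (ℤ.+ b) n ℚᵘ.+ ℚᵘ.mkℚᵘ (ℤ.+ x) 0 ℚᵘ.* ℚᵘ.mkℚᵘ (ℤ.+ 1) j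
    ≃⟨ ℚᵘ.+-cong (ℚ.toℚᵘ-fromℚᵘ (ℚᵘ.mkℚᵘ (ℤ.+ b) n))
         (ℚᵘ.≃-trans (ℚ.toℚᵘ-homo-* (ℤ.+ x ℚ./ 1) (ℤ.+ 1 ℚ./ suc j))
           (ℚᵘ.*-cong (ℚ.toℚᵘ-fromℚᵘ (ℚᵘ.mkℚᵘ (ℤ.+ x) 0)) (ℚ.toℚᵘ-fromℚᵘ (ℚᵘ.mkℚᵘ (ℤ.+ 1) j)))) ⟨
  ℚ.toℚᵘ (ℤ.+ b ℚ./ suc n) ℚᵘ.+ ℚ.toℚᵘ ((ℤ.+ x ℚ./ 1) ℚ.* (ℤ.+ 1 ℚ./ suc j))
    ≃⟨ ℚ.toℚᵘ-homo-+ (ℤ.+ b ℚ./ suc n) ((ℤ.+ x ℚ./ 1) ℚ.* (ℤ.+ 1 ℚ./ suc j)) ⟨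
  ℚ.toℚᵘ (ℤ.+ b ℚ./ suc n ℚ.+ (ℤ.+ x ℚ./ 1) ℚ.* (ℤ.+ 1 ℚ./ suc j)) ∎)
  where open ℚᵘ.≤-Reasoning

c≤C : ∀ D T → c D T ≤ leaves T C leaves D
c≤C D T = begin
  c D T                                     ≡⟨ c≡W D T ⟩
  W T (leaves D) (is D)                     ≤⟨ ∑-mono (leaves T) (leaves D) (is≤1 D ∘ induced T) ⟩
  ∑ (leaves T) (leaves D) (const 1)         ≡⟨ ∑-const (leaves T) (leaves D) 1 ⟩
  (leaves T C leaves D) * 1                 ≡⟨ *-identityʳ _ ⟩
  leaves T C leaves D                       ∎
  where open ≤-Reasoning

-- `W-graft` bounds the numerator from below and `n*[nl]Ck≤` the denominator from above. The
-- leftover c N^k L^k is at most C(N,k) k^k C(NL,k), a relative error of k^k / N.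
γ-graft : ∀ D T U x j .{{_ : NonZero j}} → j ≤ leaves T → leaves D ≤ leaves T →
          leaves D ^ leaves D ≤ x →
          γ D T ℚ.≤ γ D (graft U T) ℚ.+ (ℤ.+ x ℚ./ 1) ℚ.* (ℤ.+ 1 ℚ./ j)
γ-graft D T U x j j≤N k≤N k^k≤x = ratio-≤ x j (nCk>0 k≤N) (nCk>0 k≤NL)
  (rescale (x * (B * B′)) j≤N (begin
    N * (c D T * B′)                                ≡⟨ x∙yz≈y∙xz N (c D T) B′ ⟩
    c D T * (N * B′)                                ≡⟨ cong (λ n → c D T * (N * (n C k))) (leaves-graft U T) ⟩
    c D T * (N * (N * L C k))                       ≤⟨ *-monoʳ-≤ (c D T) (n*[nl]Ck≤ N L k) ⟩
    c D T * (L ^ k * (N * B + N ^ k))               ≡⟨ regroup (c D T) (L ^ k) N B (N ^ k) ⟩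
    N * (L ^ k * c D T * B) + c D T * (N ^ k * L ^ k)
      ≡⟨ cong (λ z → N * (L ^ k * c D T * B) + c D T * z) (trans (sym (^-distribʳ-* k N L)) (cong (_^ k) (sym (leaves-graft U T)))) ⟩
    N * (L ^ k * c D T * B) + c D T * leaves (graft U T) ^ k
      ≤⟨ +-mono-≤ (*-monoʳ-≤ N (*-monoˡ-≤ B grafted))
           (*-mono-≤ (c≤C D T) (≤-trans (n^k≤k^k*nCk k≤NL) (*-monoˡ-≤ B′ k^k≤x))) ⟩
    N * (c D (graft U T) * B) + B * (x * B′)        ≡⟨ cong (N * (c D (graft U T) * B) +_) (x∙yz≈y∙xz B x B′) ⟩
    N * (c D (graft U T) * B) + x * (B * B′)        ∎))
  where
  open ≤-Reasoning
  N = leaves T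
  L = leaves U
  k = leaves D
  B = N C k
  B′ = leaves (graft U T) C k
  k≤NL : k ≤ leaves (graft U T)
  k≤NL = subst (k ≤_) (sym (leaves-graft U T)) (≤-trans k≤N (m≤m*n N L {{>-nonZero (leaves>0 U)}}))
  grafted : L ^ k * c D T ≤ c D (graft U T)
  grafted = subst₂ (λ v w → L ^ k * v ≤ w) (sym (c≡W D T)) (sym (c≡W D (graft U T))) (W-graft U T k (is D))
  regroup : ∀ c l N B z → c * (l * (N * B + z)) ≡ N * (l * c * B) + c * (z * l)
  regroup = solve-∀

-- Maximal densities

-- Binary, hence `d`-ary for every d ≥ 2, and available with any number of leaves: grafting combs
-- enlarges a tree as far as needed.
comb : ℕ → Tree
comb zero    = node []
comb (suc j) = node (node [] ∷ comb j ∷ [])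

comb-dary : ∀ {d} j → 2 ≤ d → IsDary d (comb j)
comb-dary zero    2≤d = leaf
comb-dary (suc j) 2≤d = internal ≤-refl 2≤d (leaf ∷ comb-dary j 2≤d ∷ [])

leaves-comb : ∀ j → leaves (comb j) ≡ suc j
leaves-comb zero    = refl
leaves-comb (suc j) = cong suc (trans (+-identityʳ _) (leaves-comb j))

γ≤maxDaryγ : ∀ {d D T} → IsDary d T → γ D T ℚ.≤ maxDaryγ d D (leaves T)
γ≤maxDaryγ {d} {D} {T} T-dary = All.lookup (xs≤max 0ℚ (map (γ D) (daryTrees d (leaves T))))
  (∈-map⁺ (γ D) (Equivalence.from ∈-daryTrees (T-dary , refl)))

γ≤maxStrictlyDaryγ : ∀ {d D T} → 2 ≤ d → IsStrictlyDary d T → γ D T ℚ.≤ maxStrictlyDaryγ d D (leaves T)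
γ≤maxStrictlyDaryγ {d} {D} {T} 2≤d T-dary = All.lookup (xs≤max 0ℚ (map (γ D) (strictlyDaryTrees d (leaves T))))
  (∈-map⁺ (γ D) (Equivalence.from (∈-strictlyDaryTrees 2≤d) (T-dary , refl)))

maxStrictlyDaryγ≤ : ∀ {d D n v} → 2 ≤ d → 0ℚ ℚ.≤ v → (∀ T → IsStrictlyDary d T → leaves T ≡ n → γ D T ℚ.≤ v) →
                    maxStrictlyDaryγ d D n ℚ.≤ v
maxStrictlyDaryγ≤ {d} {D} {n} 2≤d 0≤v γ≤v = max≤v⁺ 0≤v (All.map⁺ (All.tabulate λ {T} T∈ →
  let T-dary , eq = Equivalence.to (∈-strictlyDaryTrees 2≤d) T∈ in γ≤v T T-dary eq))

0≤[x/1]*[1/j] : ∀ x j .{{_ : NonZero j}} → 0ℚ ℚ.≤ (ℤ.+ x ℚ./ 1) ℚ.* (ℤ.+ 1 ℚ./ j)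
0≤[x/1]*[1/j] x j@(suc _) = subst (ℚ._≤ (ℤ.+ x ℚ./ 1) ℚ.* (ℤ.+ 1 ℚ./ j)) (ℚ.*-zeroʳ (ℤ.+ x ℚ./ 1))
  (ℚ.*-monoˡ-≤-nonNeg (ℤ.+ x ℚ./ 1) {{ℚ.normalize-nonNeg x 1}} (ℚ.nonNegative⁻¹ (ℤ.+ 1 ℚ./ j) {{ℚ.normalize-nonNeg 1 j}}))

maxStrictlyDaryγ≤maxDaryγ : ∀ {d} D N L x j .{{_ : NonZero j}} → 2 ≤ d → j ≤ N → leaves D ≤ N →
  leaves D ^ leaves D ≤ x →
  maxStrictlyDaryγ d D N ℚ.≤ maxDaryγ d D (N * suc L) ℚ.+ (ℤ.+ x ℚ./ 1) ℚ.* (ℤ.+ 1 ℚ./ j)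
maxStrictlyDaryγ≤maxDaryγ {d} D N L x j 2≤d j≤N k≤N k^k≤x = maxStrictlyDaryγ≤ {d} {D} {N} 2≤d
  -- The maximum includes the default value 0, so the bound itself must be nonnegative.
  (ℚ.+-mono-≤ (⊥≤max 0ℚ (map (γ D) (daryTrees d (N * suc L)))) (0≤[x/1]*[1/j] x j))
  λ { T T-dary refl → ℚ.≤-trans (γ-graft D T (comb L) x j j≤N k≤N k^k≤x)
        (ℚ.+-monoˡ-≤ _ (subst (λ n → γ D (graft (comb L) T) ℚ.≤ maxDaryγ d D n)
          (trans (leaves-graft (comb L) T) (cong (leaves T *_) (leaves-comb L)))
          (γ≤maxDaryγ {D = D} (graft-dary (comb-dary L 2≤d) (strictlyDary⇒dary 2≤d T-dary))))) }

-- Densities in complete and even trees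

module _ (p : ℕ) .{{_ : NonTrivial (suc p)}} where
  open Even p

  -- `bound` is applied to the indicator of `D`. Passing to densities uses C(N,k)/N^k ≤ C(q,k)/q^k,
  -- hence the assumption N ≤ d ^ h; the error relative to C(N,k) ≥ N^k / k^k gives the constant.
  γ-K≤γ-H : ∀ D n h x j .{{_ : NonZero j}} → let N = leaves (H d n); k = leaves D in
            j ≤ N → k ≤ N → N ≤ d ^ h → coef k * k ^ k ≤ x →
            γ D (K h) ℚ.≤ γ D (H d n) ℚ.+ (ℤ.+ x ℚ./ 1) ℚ.* (ℤ.+ 1 ℚ./ j)
  γ-K≤γ-H D n h x j j≤N k≤N N≤q kx = ratio-≤ x j (nCk>0 (≤-trans k≤N N≤leaves)) (nCk>0 k≤N)
    (rescale (x * (Q * B)) j≤N (*-cancelˡ-≤ (N ^ k) {{m^n≢0 N k {{>-nonZero (leaves>0 (H d n))}}}} (begin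
      N ^ k * (N * (c D (K h) * B))                 ≡⟨ regroup (N ^ k) N (c D (K h)) B ⟩
      N * B * (N ^ k * c D (K h))                   ≤⟨ *-monoʳ-≤ (N * B) c-bound ⟩
      N * B * (q ^ k * (c D (H d n) + e))           ≡⟨ regroup′ N B (q ^ k) (c D (H d n) + e) ⟩
      N * (c D (H d n) + e) * (B * q ^ k)           ≤⟨ *-monoʳ-≤ (N * (c D (H d n) + e)) (nCk*q^k≤qCk*n^k k N≤q) ⟩
      N * (c D (H d n) + e) * ((q C k) * N ^ k)     ≡⟨ cong (λ q → N * (c D (H d n) + e) * ((q C k) * N ^ k)) (leaves-K h) ⟨
      N * (c D (H d n) + e) * (Q * N ^ k)           ≡⟨ regroup″ N (c D (H d n)) e Q (N ^ k) ⟩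
      N ^ k * (N * (c D (H d n) * Q) + N * e * Q)
        ≤⟨ *-monoʳ-≤ (N ^ k) (+-monoʳ-≤ (N * (c D (H d n) * Q)) (*-monoˡ-≤ Q Ne≤xB)) ⟩
      N ^ k * (N * (c D (H d n) * Q) + x * B * Q)   ≡⟨ cong (λ z → N ^ k * (N * (c D (H d n) * Q) + z)) (regroup‴ x B Q) ⟩
      N ^ k * (N * (c D (H d n) * Q) + x * (Q * B)) ∎)))
    where
    open ≤-Reasoning
    N = leaves (H d n)
    k = leaves D
    q = d ^ h
    B = N C k
    Q = leaves (K h) C k
    e = error (coef k) N k
    N≤leaves : N ≤ leaves (K h)
    N≤leaves = subst (N ≤_) (sym (leaves-K h)) N≤q
    c-bound : N ^ k * c D (K h) ≤ q ^ k * (c D (H d n) + e)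
    c-bound = subst₂ (λ v w → N ^ k * v ≤ q ^ k * w) (sym (c≡W D (K h)))
      (cong₂ _+_ (sym (c≡W D (H d n))) (*-identityʳ e)) (bound k h n (is D) 1 (is≤1 D))
    Ne≤xB : N * e ≤ x * B
    Ne≤xB = begin
      N * e                      ≤⟨ N*error≤ (coef k) N k ⟩
      coef k * N ^ k             ≤⟨ *-monoʳ-≤ (coef k) (n^k≤k^k*nCk k≤N) ⟩
      coef k * (k ^ k * B)       ≡⟨ *-assoc (coef k) (k ^ k) B ⟨
      coef k * k ^ k * B         ≤⟨ *-monoˡ-≤ B kx ⟩
      x * B                      ∎
    regroup : ∀ z N c B → z * (N * (c * B)) ≡ N * B * (z * c)
    regroup = solve-∀
    regroup′ : ∀ N B q c → N * B * (q * c) ≡ N * c * (B * q)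
    regroup′ = solve-∀
    regroup″ : ∀ N c e Q z → N * (c + e) * (Q * z) ≡ z * (N * (c * Q) + N * e * Q)
    regroup″ = solve-∀
    regroup‴ : ∀ x B Q → x * B * Q ≡ x * (Q * B)
    regroup‴ = solve-∀

-- Real numbers

[p+q]-q≡p : ∀ p q → (p ℚ.+ q) ℚ.- q ≡ p
[p+q]-q≡p = solve 2 (λ p q → (p :+ q) :- q := p) refl
  where open +-*-Solver

[p-q]+q≡p : ∀ p q → (p ℚ.- q) ℚ.+ q ≡ p
[p-q]+q≡p = solve 2 (λ p q → (p :- q) :+ q := p) refl
  where open +-*-Solver

p≤r+q⇒p-q≤r : ∀ {p q r} → p ℚ.≤ r ℚ.+ q → p ℚ.- q ℚ.≤ r
p≤r+q⇒p-q≤r {p} {q} {r} l = subst (p ℚ.- q ℚ.≤_) ([p+q]-q≡p r q) (ℚ.+-monoˡ-≤ (ℚ.- q) l)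

p-q≤r⇒p≤r+q : ∀ {p q r} → p ℚ.- q ℚ.≤ r → p ℚ.≤ r ℚ.+ q
p-q≤r⇒p≤r+q {p} {q} {r} l = subst (ℚ._≤ r ℚ.+ q) ([p-q]+q≡p p q) (ℚ.+-monoˡ-≤ q l)

p≤∣p∣ : ∀ p → p ℚ.≤ ℚ.∣ p ∣
p≤∣p∣ p with ℚ.≤-total 0ℚ p
... | inj₁ 0≤p = ℚ.≤-reflexive (sym (ℚ.0≤p⇒∣p∣≡p 0≤p))
... | inj₂ p≤0 = ℚ.≤-trans p≤0 (ℚ.0≤∣p∣ p)

-[p-q]≡q-p : ∀ p q → ℚ.- (p ℚ.- q) ≡ q ℚ.- p
-[p-q]≡q-p = solve 2 (λ p q → :- (p :- q) := q :- p) refl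
  where open +-*-Solver

∣p-q∣≤r : ∀ p q {r} → p ℚ.- q ℚ.≤ r → q ℚ.- p ℚ.≤ r → ℚ.∣ p ℚ.- q ∣ ℚ.≤ r
∣p-q∣≤r p q {r} l k with ℚ.∣p∣≡p∨∣p∣≡-p (p ℚ.- q)
... | inj₁ eq = subst (ℚ._≤ r) (sym eq) l
... | inj₂ eq = subst (ℚ._≤ r) (sym (trans eq (-[p-q]≡q-p p q))) k

½ε>0 : ∀ {ε} → 0ℚ ℚ.< ε → 0ℚ ℚ.< ½ ℚ.* ε
½ε>0 {ε} 0<ε = subst (ℚ._< ½ ℚ.* ε) (ℚ.*-zeroʳ ½) (ℚ.*-monoʳ-<-pos ½ 0<ε)

½ε+½ε≡ε : ∀ ε → ½ ℚ.* ε ℚ.+ ½ ℚ.* ε ≡ ε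
½ε+½ε≡ε ε = trans (sym (ℚ.*-distribʳ-+ ε ½ ½)) (ℚ.*-identityˡ ε)

≤ᴿ-trans : ∀ {x y z} → x ≤ᴿ y → y ≤ᴿ z → x ≤ᴿ z
≤ᴿ-trans {x} {y} {z} x≤y y≤z ε 0<ε =
  let M , p = x≤y (½ ℚ.* ε) (½ε>0 0<ε)
      N , q = y≤z (½ ℚ.* ε) (½ε>0 0<ε)
  in M ℕ.⊔ N , λ n l → ℚ.≤-trans (p n (≤-trans (m≤m⊔n M N) l))
       (ℚ.≤-trans (ℚ.+-monoˡ-≤ (½ ℚ.* ε) (q n (≤-trans (m≤n⊔m M N) l)))
         (ℚ.≤-reflexive (trans (ℚ.+-assoc (seq z n) (½ ℚ.* ε) (½ ℚ.* ε)) (cong (seq z n ℚ.+_) (½ε+½ε≡ε ε)))))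

∣q-x∣≤r : ∀ q r {x} → fromℚ (q ℚ.- r) ≤ᴿ x → x ≤ᴿ fromℚ (q ℚ.+ r) → ∣ fromℚ q -ᴿ x ∣ᴿ ≤ᴿ fromℚ r
∣q-x∣≤r q r {x} lower upper ε 0<ε =
  let M , p = lower ε 0<ε
      N , s = upper ε 0<ε
  in M ℕ.⊔ N , λ n l → ∣p-q∣≤r q (seq x n)
       (p≤r+q⇒p-q≤r (subst (q ℚ.≤_) (regroup (seq x n) ε r) (p-q≤r⇒p≤r+q (p n (≤-trans (m≤m⊔n M N) l)))))
       (p≤r+q⇒p-q≤r (subst (seq x n ℚ.≤_) (regroup′ q r ε) (s n (≤-trans (m≤n⊔m M N) l))))
  where
  open +-*-Solver
  regroup : ∀ x ε r → (x ℚ.+ ε) ℚ.+ r ≡ (r ℚ.+ ε) ℚ.+ x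
  regroup = solve 3 (λ x ε r → (x :+ ε) :+ r := (r :+ ε) :+ x) refl
  regroup′ : ∀ q r ε → (q ℚ.+ r) ℚ.+ ε ≡ (r ℚ.+ ε) ℚ.+ q
  regroup′ = solve 3 (λ q r ε → (q :+ r) :+ ε := (r :+ ε) :+ q) refl

-- Every tail contains a term at least `v`, so all tail suprema, and with them their infimum, are at
-- least `v`.
≤-limsup : ∀ (a : ℕ → ℚ) v {L} → IsLimsup (λ n → fromℚ (a n)) L → (∀ m → ∃ λ n → m ≤ n × v ℚ.≤ a n) → fromℚ v ≤ᴿ L
≤-limsup a v {L} (s , sups , inf) cofinal = proj₂ inf (fromℚ v) v≤s
  where
  v≤s : ∀ m → fromℚ v ≤ᴿ s m
  v≤s m ε 0<ε with cofinal m
  ... | n , m≤n , v≤a with m≤n⇒∃[o]m+o≡n m≤n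
  ...   | k , refl = let N , p = proj₁ (sups m) k ε 0<ε in N , λ i l → ℚ.≤-trans v≤a (p i l)

limit-≤ : ∀ (a : ℕ → ℚ) v {L} → IsLimit (λ n → fromℚ (a n)) L → (∀ m → ∃ λ n → m ≤ n × a n ℚ.≤ v) → L ≤ᴿ fromℚ v
-- A single late term suffices. One half of `ε` is its distance to the limit, the other the slack of
-- `_≤ᴿ_` in the statement of that distance.
limit-≤ a v {L} lim cofinal ε 0<ε with lim (½ ℚ.* ε) (½ε>0 0<ε)
... | m , close with cofinal m
...   | n , m≤n , a≤v with close n m≤n (½ ℚ.* ε) (½ε>0 0<ε)
...     | N , p = N , λ i l → begin
  seq L i             ≤⟨ p-q≤r⇒p≤r+q (ℚ.≤-trans (p≤∣p∣ (seq L i ℚ.- a n)) (ℚ.≤-trans (ℚ.≤-reflexive (flip i)) (p i l))) ⟩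
  (½ ℚ.* ε ℚ.+ ½ ℚ.* ε) ℚ.+ a n ≡⟨ cong (ℚ._+ a n) (½ε+½ε≡ε ε) ⟩
  ε ℚ.+ a n           ≡⟨ ℚ.+-comm ε (a n) ⟩
  a n ℚ.+ ε           ≤⟨ ℚ.+-monoˡ-≤ ε a≤v ⟩
  v ℚ.+ ε             ∎
  where
  open ℚ.≤-Reasoning
  flip : ∀ i → ℚ.∣ seq L i ℚ.- a n ∣ ≡ ℚ.∣ a n ℚ.- seq L i ∣
  flip i = trans (sym (ℚ.∣-p∣≡∣p∣ (seq L i ℚ.- a n))) (cong ℚ.∣_∣ (-[p-q]≡q-p (seq L i) (a n)))

-- Both bounds on the maximal density of strictly d-ary trees

theorem10 : (d : ℕ) .{{_ : NonTrivial d}} (D : Tree) → IsDary d D →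
    (I η : ℝ) → IsInducibility d D I → IsBalancedDensity d D η →
    I ≈ᴿ η →
    IsO[1/n] (λ n → fromℚ (maxStrictlyDaryγ d D ((d ∸ 1) * n + 1)) -ᴿ I)
theorem10 zero {{nt}} with nonTrivial⇒n>1 0 {{nt}}
... | ()
theorem10 (suc p) D _ I η inducibility density (I≤η , _) = ℤ.+ x ℚ./ 1 , k , λ n k≤n →
  ∣q-x∣≤r (g n) (r n) {I}
    -- Grafting a comb with m + 1 leaves shows that the density g n - r n is reached by `d`-ary
    -- trees with more than `m` leaves, for every `m`.
    (≤-limsup (λ N → maxDaryγ d D N) (g n ℚ.- r n) {I} inducibility λ m →
      N n * suc m , ≤-trans (n≤1+n m) (m≤n*m (suc m) (N n) {{>-nonZero (N>0 n)}}) ,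
      p≤r+q⇒p-q≤r (maxStrictlyDaryγ≤maxDaryγ D (N n) m x n 2≤d (n≤N n) (≤-trans k≤n (n≤N n)) (m≤m+n (k ^ k) _)))
    (≤ᴿ-trans {I} {η} {fromℚ (g n ℚ.+ r n)} I≤η (limit-≤ (λ n → γ D (H d n)) (g n ℚ.+ r n) {η} density λ m →
      -- The summand `m` in the height takes the index beyond `m`; the summand `N n` makes the
      -- complete tree at least as large as `H d n`.
      completeIndex (m + N n) , ≤-trans (m≤m+n m (N n)) (h≤completeIndex (m + N n)) ,
      ℚ.≤-trans
        (γ-K≤γ-H p D n (m + N n) x n (≤-trans (n≤N n) (N≤leaves n)) (≤-trans k≤n (≤-trans (n≤N n) (N≤leaves n)))
          (leaves≤d^ n m) (m≤n+m (coef k * k ^ k) (k ^ k)))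
        (ℚ.+-monoˡ-≤ (r n) (subst (λ N → γ D (H d n) ℚ.≤ maxStrictlyDaryγ d D N) (leaves-H n)
          (γ≤maxStrictlyDaryγ {D = D} 2≤d (H-strictlyDary n))))))
  where
  open Even p
  2≤d : 2 ≤ d
  2≤d = nonTrivial⇒n>1 d
  k x : ℕ
  k = leaves D
  -- The sum covers the constants of both bounds: `k ^ k` from grafting, the rest from the
  -- comparison with complete trees.
  x = k ^ k + coef k * k ^ k
  N : ℕ → ℕ
  N n = p * n + 1
  g : ℕ → ℚ
  g n = maxStrictlyDaryγ d D (N n)
  r : ∀ n .{{_ : NonZero n}} → ℚ
  r n = (ℤ.+ x ℚ./ 1) ℚ.* (ℤ.+ 1 ℚ./ n)
  N>0 : ∀ n → 0 < N n
  N>0 n = m≤n+m 1 (p * n)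
  n≤N : ∀ n → n ≤ N n
  n≤N n = ≤-trans (m≤n*m n p {{>-nonZero 1≤p}}) (m≤m+n (p * n) 1)
  N≤leaves : ∀ n → N n ≤ leaves (H d n)
  N≤leaves n = ≤-reflexive (sym (leaves-H n))
  leaves≤d^ : ∀ n m → leaves (H d n) ≤ d ^ (m + N n)
  leaves≤d^ n m = begin
    leaves (H d n)                    ≡⟨ leaves-H n ⟩
    N n                               ≤⟨ m≤n+m (N n) m ⟩
    m + N n                           ≤⟨ h≤completeIndex (m + N n) ⟩
    completeIndex (m + N n)           ≤⟨ n≤N (completeIndex (m + N n)) ⟩
    N (completeIndex (m + N n))       ≡⟨ leaves-H (completeIndex (m + N n)) ⟨
    leaves (K (m + N n))              ≡⟨ leaves-K (m + N n) ⟩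
    d ^ (m + N n)                     ∎
    where open ≤-Reasoning
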